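{- Let $T(x,y):=\sum_{n\ge 1}x^n\sum_{T\in\mathcal{T}^{(2)}(K_{1,3}\times P_n)}y^{\rho(T)}$ be the bivariate generating function for the $2$-colored partitions of the graphs $K_{1,3}\times P_n$. Then $T(x,y)=p(x,y)/q(x,y)$, where \begin{align*} p(x,y) ={}&(2y^4 + 6y^3 + 6y^2 + 2y)x + (-8y^7 + 4y^6 - 28y^5 + 40y^4 - 44y^3 + 4y^2 - 16y)x^2\\ &+ (14y^9 - 22y^8 - 4y^7 + 104y^6 - 106y^5 - 32y^4 + 90y^3 - 52y^2 + 40y)x^3\\ &+ (-8y^{10} - 8y^9 + 124y^8 - 204y^7 + 52y^6 + 64y^5 + 16y^4 - 80y^3 + 92y^2 - 48y)x^4\\ &+ (-10y^{11} + 4y^{10} + 110y^9 - 268y^8 + 112y^7 + 384y^6 - 662y^5 + 468y^4 - 120y^3 - 48y^2 + 30y)x^5\\ &+ (16y^{11} - 28y^{10} - 156y^9 + 656y^8 - 1028y^7 + 708y^6 - 316y^4 + 168y^3 - 12y^2 - 8y)x^6\\ &+ (8y^{11} - 58y^{10} + 228y^9 - 562y^8 + 852y^7 - 756y^6 + 340y^5 - 26y^4 - 36y^3 + 10y^2)x^7 \end{align*} and \begin{align*} q(x,y) ={}& 1 + (-y^4 - y^3 - y^2 - 7y - 9)x + (y^7 + y^6 + 5y^5 + 11y^4 - 4y^3 - 6y^2 + 14y + 28)x^2\\ &+ (-y^9 - 3y^8 + y^7 + 5y^6 - 22y^5 - 11y^4 + 7y^3 + 54y^2 - 18y - 44)x^3\\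 &+ (7y^9 - 17y^8 + 2y^7 + 20y^6 - 32y^5 + 45y^4 + 42y^3 - 105y^2 - y + 39)x^4\\ &+ (y^{11} + 4y^{10} - 24y^9 + 47y^8 - 28y^7 - 62y^6 + 167y^5 - 125y^4 - 50y^3 + 83y^2 + 6y - 19)x^5\\ &+ (y^{11} - 24y^{10} + 94y^9 - 122y^8 - 61y^7 + 365y^6 - 409y^5 + 116y^4 + 116y^3 - 91y^2 + 11y + 4)x^6\\ &+ (-3y^{11} + 23y^{10} - 74y^9 + 95y^8 + 45y^7 - 289y^6 + 355y^5 - 183y^4 + 18y^3 + 18y^2 - 5y)x^7. \end{align*}
   Context: $K_{1,3}$ is the star graph (complete bipartite graph with parts of sizes $1$ and $3$) and $P_n$ the path graph on $n$ vertices. The product $G_1\times G_2$ of graphs $G_1=(V_1,E_1)$, $G_2=(V_2,E_2)$ is the Cartesian product: its vertex set is $V_1\times V_2$, and $(v_1,v_2),(w_1,w_2)$ are adjacent iff ($v_1=w_1$ and $\{v_2,w_2\}\in E_2$) or ($v_2=w_2$ and $\{v_1,w_1\}\in E_1$). For a finite undirected graph $G=(V,E)$, two nonempty disjoint subsets $V_1,V_2\subseteq V$ are neighbors if there is an edge of $G$ with one endpoint in $V_1$ and the other in $V_2$. A $k$-colored partition of $G$ is a partition $V=\bigcup_{i=1}^s V_i$ together with an assignment of one of $k$ colors to each $V_i$ (all vertices of $V_i$ get that color), such that each $V_i$ induces a connected subgraph of $G$ and any two neighboring sets $V_i,V_j$ have different colors. The sets $V_i$ are the blocks, and the size $\rho(T)$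 of a $k$-colored partition $T$ is its number of blocks. $\mathcal{T}^{(k)}(G)$ denotes the set of all $k$-colored partitions of $G$. Generating functions are formal power series in $x$ with coefficients polynomial in $y$. -}

module Defs where

open import Agda.Builtin.FromNat using (Number; fromNat)
open import Agda.Builtin.FromNeg using (Negative; fromNeg)
open import Data.Empty using (⊥)
open import Data.Fin.Base using (Fin; toℕ)
open import Data.Fin.Properties using (+↔⊎; *↔×)
import Data.Integer.Base as ℤ
import Data.Integer.Literals as ℤ-Literals
open import Data.Integer.Base using (ℤ; 0ℤ; 1ℤ)
open import Data.List.Base using (List; []; _∷_; [_]; _++_; map; foldr; replicate; upTo)
import Data.List.Relation.Unary.Enumerates.Setoid as Enumerates
import Data.List.Relation.Unary.Unique.Setoid as UniqueSetoid
open import Data.Nat.Base using (ℕ; zero; suc; _∸_)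
import Data.Nat.Literals as ℕ-Literals
open import Data.Nat.Properties using (1+n≢n)
open import Data.Product.Base using (∃; _×_; _,_; proj₂)
open import Data.Product.Function.NonDependent.Propositional using (_×-↔_)
open import Data.Sum.Base as Sum using (_⊎_; inj₁; inj₂; swap)
open import Data.Unit.Base using (⊤; tt)
open import Function.Bundles using (_↔_)
open import Function.Construct.Composition using (_↔-∘_)
open import Function.Construct.Identity using (↔-id)
open import Level using (Level; 0ℓ; _⊔_) renaming (suc to lsuc)
open import Relation.Binary.Bundles using (Setoid)
open import Relation.Binary.Construct.Closure.ReflexiveTransitive using (Star)
open import Relation.Binary.Core using (Rel)
open import Relation.Binary.Definitions using (Symmetric)
open import Relation.Binary.PropositionalEquality using (_≡_; _≢_; refl; sym; trans)
open import Relation.Nullary.Negation using (¬_)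
open import Relation.Unary using (Pred; _∈_; _≐_; Satisfiable)
open import Relation.Unary.Properties using (≐-refl; ≐-trans)

private instance
  ℕ-number : Number ℕ
  ℕ-number = ℕ-Literals.number

  ℤ-number : Number ℤ
  ℤ-number = ℤ-Literals.number

  ℤ-negative : Negative ℤ
  ℤ-negative = ℤ-Literals.negative

record Graph : Set₁ where
  field
    V      : Set
    _~_    : Rel V 0ℓ
    ~-sym  : Symmetric _~_
    irrefl : ∀ v → ¬ (v ~ v)
    finite : ∃ λ n → Fin n ↔ V

K : ℕ → ℕ → Graph
K m n = record
  { V      = Fin m ⊎ Fin n
  ; _~_    = _~_
  ; ~-sym  = λ {v} {w} → ~-sym v w
  ; irrefl = λ { (inj₁ _) () ; (inj₂ _) () }
  ; finite = _ , +↔⊎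
  }
  where
  _~_ : Rel (Fin m ⊎ Fin n) 0ℓ
  inj₁ _ ~ inj₁ _ = ⊥
  inj₁ _ ~ inj₂ _ = ⊤
  inj₂ _ ~ inj₁ _ = ⊤
  inj₂ _ ~ inj₂ _ = ⊥

  ~-sym : ∀ v w → v ~ w → w ~ v
  ~-sym (inj₁ _) (inj₂ _) _ = tt
  ~-sym (inj₂ _) (inj₁ _) _ = tt

P : ℕ → Graph
P n = record
  { V      = Fin n
  ; _~_    = λ i j → suc (toℕ i) ≡ toℕ j ⊎ suc (toℕ j) ≡ toℕ i
  ; ~-sym  = swap
  ; irrefl = λ _ → Sum.[ 1+n≢n , 1+n≢n ]
  ; finite = n , ↔-id _
  }

infixr 7 _□_

_□_ : Graph → Graph → Graph
G₁ □ G₂ = record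
  { V      = G₁.V × G₂.V
  ; _~_    = λ (v₁ , v₂) (w₁ , w₂) → (v₁ ≡ w₁ × v₂ G₂.~ w₂) ⊎ (v₂ ≡ w₂ × v₁ G₁.~ w₁)
  ; ~-sym  = λ { (inj₁ (e , a)) → inj₁ (sym e , G₂.~-sym a)
               ; (inj₂ (e , a)) → inj₂ (sym e , G₁.~-sym a) }
  ; irrefl = λ { (_ , v₂) (inj₁ (_ , a)) → G₂.irrefl v₂ a
               ; (v₁ , _) (inj₂ (_ , a)) → G₁.irrefl v₁ a }
  ; finite = _ , ((proj₂ G₁.finite ×-↔ proj₂ G₂.finite) ↔-∘ *↔×)
  }
  where
  module G₁ = Graph G₁
  module G₂ = Graph G₂

module _ (G : Graph) where
  open Graph G

  Neighbors : Pred V 0ℓ → Pred V 0ℓ → Set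
  Neighbors U W = ∃ λ v → ∃ λ w → v ∈ U × w ∈ W × v ~ w

  -- Adjacency in the subgraph induced by U.  It is kept as a relation on V, not on
  -- Σ V U, so that distinct proofs of v ∈ U do not give distinct vertices.
  Induced : Pred V 0ℓ → Rel V 0ℓ
  Induced U v w = v ∈ U × w ∈ U × v ~ w

  Connected : Pred V 0ℓ → Set
  Connected U = ∀ {v w} → v ∈ U → w ∈ U → Star (Induced U) v w

record ColoredPartition (k : ℕ) (G : Graph) : Set₁ where
  open Graph G
  field
    size      : ℕ
    block     : Fin size → Pred V 0ℓ
    color     : Fin size → Fin k
    nonempty  : ∀ i → Satisfiable (block i)
    disjoint  : ∀ {i j v} → v ∈ block i → v ∈ block j → i ≡ j
    cover     : ∀ v → ∃ λ i → v ∈ block i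
    connected : ∀ i → Connected G (block i)
    proper    : ∀ {i j} → i ≢ j → Neighbors G (block i) (block j) → color i ≢ color j

module _ {k : ℕ} {G : Graph} where
  open ColoredPartition

  infix 4 _⊑_

  _⊑_ : Rel (ColoredPartition k G) 0ℓ
  S ⊑ T = ∀ i → ∃ λ j → block S i ≐ block T j × color S i ≡ color T j

  ⊑-refl : ∀ {S} → S ⊑ S
  ⊑-refl i = i , ≐-refl , refl

  ⊑-trans : ∀ {S T U} → S ⊑ T → T ⊑ U → S ⊑ U
  ⊑-trans f g i with f i
  ... | j , b , c with g j
  ...   | l , b′ , c′ = l , ≐-trans b b′ , trans c c′

-- The indexing of the blocks is immaterial: colored partitions are identified when they
-- have the same set of colored blocks.
𝒯 : ℕ → Graph → Setoid (lsuc 0ℓ) 0ℓ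
𝒯 k G = record
  { Carrier       = ColoredPartition k G
  ; _≈_           = λ S T → S ⊑ T × T ⊑ S
  ; isEquivalence = record
    { refl  = λ {S} → ⊑-refl {S = S} , ⊑-refl {S = S}
    ; sym   = λ (f , g) → g , f
    ; trans = λ {S} {T} {U} (f , f′) (g , g′) →
        ⊑-trans {S = S} {T} {U} f g , ⊑-trans {S = U} {T} {S} g′ f′
    }
  }

-- A list containing every element of S exactly once, up to the equality of S.
record Enumeration {a ℓ : Level} (S : Setoid a ℓ) : Set (a ⊔ ℓ) where
  open Enumerates S using (IsEnumeration)
  open UniqueSetoid S using (Unique)
  field
    elements : List (Setoid.Carrier S)
    complete : IsEnumeration elements
    unique   : Unique elements

-- ℤ[y]: coefficient lists, constant term first, compared by _≈ₚ_ since trailing zeros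
-- are allowed.
Poly : Set
Poly = List ℤ

coeff : Poly → ℕ → ℤ
coeff []      _       = 0ℤ
coeff (a ∷ f) zero    = a
coeff (a ∷ f) (suc m) = coeff f m

infix 4 _≈ₚ_ _≈ₛ_
infixr 6 _⊕_
infixl 7 _⊗_ _⊛_
infix 8 _y^_

_≈ₚ_ : Rel Poly 0ℓ
f ≈ₚ g = ∀ m → coeff f m ≡ coeff g m

0ₚ : Poly
0ₚ = []

_y^_ : ℤ → ℕ → Poly
a y^ m = replicate m 0ℤ ++ [ a ]

_⊕_ : Poly → Poly → Poly
[]      ⊕ g       = g
(a ∷ f) ⊕ []      = a ∷ f
(a ∷ f) ⊕ (b ∷ g) = a ℤ.+ b ∷ f ⊕ g

_⊗_ : Poly → Poly → Poly
[]      ⊗ g = []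
(a ∷ f) ⊗ g = map (a ℤ.*_) g ⊕ (0ℤ ∷ f ⊗ g)

Σₚ : List Poly → Poly
Σₚ = foldr _⊕_ 0ₚ

-- ℤ[y][[x]]: F n is the coefficient of xⁿ.
Series : Set
Series = ℕ → Poly

_≈ₛ_ : Rel Series 0ℓ
F ≈ₛ H = ∀ n → F n ≈ₚ H n

_⊛_ : Series → Series → Series
(F ⊛ H) n = Σₚ (map (λ i → F i ⊗ H (n ∸ i)) (upTo (suc n)))

-- F = N / D for a denominator D with constant coefficient 1, which is a unit of ℤ[y][[x]].
infix 4 _≈_÷_
_≈_÷_ : Series → Series → Series → Set
F ≈ N ÷ D = D 0 ≈ₚ 1ℤ y^ 0 × D ⊛ F ≈ₛ N

-- Σ_{n ≥ 1} xⁿ Σ_{T ∈ 𝒯 k (G n)} y^ρ(T), computed from enumerations of the sets 𝒯 k (G n).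
genFun : ∀ {k} (G : ℕ → Graph) → (∀ n → Enumeration (𝒯 k (G n))) → Series
genFun G e zero    = 0ₚ
genFun G e (suc n) =
  Σₚ (map (λ T → 1ℤ y^ ColoredPartition.size T) (Enumeration.elements (e (suc n))))

p : Series
p 0 = 0ₚ
p 1 = 2 y^ 4 ⊕ 6 y^ 3 ⊕ 6 y^ 2 ⊕ 2 y^ 1
p 2 = -8 y^ 7 ⊕ 4 y^ 6 ⊕ -28 y^ 5 ⊕ 40 y^ 4 ⊕ -44 y^ 3 ⊕ 4 y^ 2 ⊕ -16 y^ 1
p 3 = 14 y^ 9 ⊕ -22 y^ 8 ⊕ -4 y^ 7 ⊕ 104 y^ 6 ⊕ -106 y^ 5 ⊕ -32 y^ 4 ⊕ 90 y^ 3 ⊕ -52 y^ 2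
    ⊕ 40 y^ 1
p 4 = -8 y^ 10 ⊕ -8 y^ 9 ⊕ 124 y^ 8 ⊕ -204 y^ 7 ⊕ 52 y^ 6 ⊕ 64 y^ 5 ⊕ 16 y^ 4 ⊕ -80 y^ 3
    ⊕ 92 y^ 2 ⊕ -48 y^ 1
p 5 = -10 y^ 11 ⊕ 4 y^ 10 ⊕ 110 y^ 9 ⊕ -268 y^ 8 ⊕ 112 y^ 7 ⊕ 384 y^ 6 ⊕ -662 y^ 5
    ⊕ 468 y^ 4 ⊕ -120 y^ 3 ⊕ -48 y^ 2 ⊕ 30 y^ 1
p 6 = 16 y^ 11 ⊕ -28 y^ 10 ⊕ -156 y^ 9 ⊕ 656 y^ 8 ⊕ -1028 y^ 7 ⊕ 708 y^ 6 ⊕ -316 y^ 4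
    ⊕ 168 y^ 3 ⊕ -12 y^ 2 ⊕ -8 y^ 1
p 7 = 8 y^ 11 ⊕ -58 y^ 10 ⊕ 228 y^ 9 ⊕ -562 y^ 8 ⊕ 852 y^ 7 ⊕ -756 y^ 6 ⊕ 340 y^ 5
    ⊕ -26 y^ 4 ⊕ -36 y^ 3 ⊕ 10 y^ 2
p _ = 0ₚ

q : Series
q 0 = 1 y^ 0
q 1 = -1 y^ 4 ⊕ -1 y^ 3 ⊕ -1 y^ 2 ⊕ -7 y^ 1 ⊕ -9 y^ 0
q 2 = 1 y^ 7 ⊕ 1 y^ 6 ⊕ 5 y^ 5 ⊕ 11 y^ 4 ⊕ -4 y^ 3 ⊕ -6 y^ 2 ⊕ 14 y^ 1 ⊕ 28 y^ 0
q 3 = -1 y^ 9 ⊕ -3 y^ 8 ⊕ 1 y^ 7 ⊕ 5 y^ 6 ⊕ -22 y^ 5 ⊕ -11 y^ 4 ⊕ 7 y^ 3 ⊕ 54 y^ 2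
    ⊕ -18 y^ 1 ⊕ -44 y^ 0
q 4 = 7 y^ 9 ⊕ -17 y^ 8 ⊕ 2 y^ 7 ⊕ 20 y^ 6 ⊕ -32 y^ 5 ⊕ 45 y^ 4 ⊕ 42 y^ 3 ⊕ -105 y^ 2
    ⊕ -1 y^ 1 ⊕ 39 y^ 0
q 5 = 1 y^ 11 ⊕ 4 y^ 10 ⊕ -24 y^ 9 ⊕ 47 y^ 8 ⊕ -28 y^ 7 ⊕ -62 y^ 6 ⊕ 167 y^ 5 ⊕ -125 y^ 4
    ⊕ -50 y^ 3 ⊕ 83 y^ 2 ⊕ 6 y^ 1 ⊕ -19 y^ 0
q 6 = 1 y^ 11 ⊕ -24 y^ 10 ⊕ 94 y^ 9 ⊕ -122 y^ 8 ⊕ -61 y^ 7 ⊕ 365 y^ 6 ⊕ -409 y^ 5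
    ⊕ 116 y^ 4 ⊕ 116 y^ 3 ⊕ -91 y^ 2 ⊕ 11 y^ 1 ⊕ 4 y^ 0
q 7 = -3 y^ 11 ⊕ 23 y^ 10 ⊕ -74 y^ 9 ⊕ 95 y^ 8 ⊕ 45 y^ 7 ⊕ -289 y^ 6 ⊕ 355 y^ 5
    ⊕ -183 y^ 4 ⊕ 18 y^ 3 ⊕ 18 y^ 2 ⊕ -5 y^ 1
q _ = 0ₚ

{-# OPTIONS --safe #-}

-- With two colors, a colored partition is determined by the coloring of the vertices: its
-- blocks are the monochromatic components.  So T(x, y) counts colorings of K₁,₃ × Pₙ by their
-- number of monochromatic components, and a transfer matrix does the counting.  Columns are
-- added one at a time; all that matters about the earlier ones is the coloring of the last
-- column and which of its four vertices are already connected.  Leaves of the color of the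
-- center are connected to it, so the connectivity, together with the color of the center,
-- determines the coloring of the column: there are 2 · Bell(4) = 30 states.
--
-- Let W s n be the sum of y^(number of components meeting the column of s or a later one) over
-- all ways to add n columns.  Then W s (n + 1) = Σ_c y^(δ s c) W (step s c) n, where δ s c
-- counts the components that end in state s when column c is added.  This recursion is linear,
-- so Σ_k q_k W s (n - k) = 0 for all n ≥ 7 as soon as it holds for n = 7, which is a finite
-- computation, like the comparison with p up to x⁷.

module Submission where

open import Defs
open import Algebra.Properties.CommutativeSemigroup using (x∙yz≈y∙xz)
open import Data.Bool.Base using (Bool; if_then_else_; _∧_; T)
import Data.Bool.Properties as Bool
open import Data.Fin.Base using
  (Fin; zero; suc; toℕ; fromℕ<; opposite; _↑ˡ_; _↑ʳ_; splitAt; join; punchIn; punchOut)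
open import Data.Fin.Patterns using (0F; 1F; 2F; 3F; 4F; 5F; 6F; 7F)
import Data.Fin.Properties as Fin
open import Data.Integer.Base as ℤ using (0ℤ; 1ℤ)
import Data.Integer.Properties as ℤ
open import Data.List.Base as List using
  (List; []; _∷_; _++_; map; upTo; applyUpTo; iterate; replicate; filter; cartesianProductWith)
open import Data.List.Membership.Propositional using (_∈_)
open import Data.List.Membership.Propositional.Properties using
  (∈-map⁺; ∈-filter⁺; ∈-cartesianProductWith⁺; ∈-allFin)
open import Data.List.Membership.Propositional.Properties.WithK using (unique∧set⇒bag)
import Data.List.Properties as List
open import Data.List.Relation.Binary.BagAndSetEquality using (∼bag⇒↭)
open import Data.List.Relation.Binary.Permutation.Propositional as Perm using (_↭_)
open import Data.List.Relation.Unary.All as All using (All; []; _∷_)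
import Data.List.Relation.Unary.All.Properties as All
open import Data.List.Relation.Unary.Any as Any using (here; there)
import Data.List.Relation.Unary.Any.Properties as Any
open import Data.List.Relation.Unary.Unique.Propositional using (Unique; []; _∷_)
import Data.List.Relation.Unary.Unique.Propositional.Properties as Unique
import Data.List.Relation.Unary.Unique.Setoid.Properties as UniqueSetoid
open import Data.Nat.Base using (ℕ; zero; suc; _+_; _∸_; _⊔_; _≤_; _<_; s≤s; s<s; _≡ᵇ_)
import Data.Nat.Properties as ℕ
open import Data.Product.Base using (∃; _×_; _,_; proj₁; proj₂; swap; uncurry)
open import Data.Sum.Base using (_⊎_; inj₁; inj₂; [_,_]′)
open import Data.Unit.Base using (tt)
open import Data.Vec.Base as Vec using (Vec; []; _∷_; lookup; tabulate)
import Data.Vec.Properties as Vec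
open import Function.Base using (_∘_; id; flip)
open import Function.Bundles using (mk⇔)
open import Function.Definitions using (Injective)
open import Level using (0ℓ)
open import Relation.Binary.Bundles using (Setoid)
open import Relation.Binary.Construct.Closure.ReflexiveTransitive as Star using (Star; ε; _◅_; _◅◅_)
open import Relation.Binary.Core using (Rel)
open import Relation.Binary.Definitions using (Symmetric; Transitive)
open import Relation.Binary.PropositionalEquality using
  (_≡_; _≢_; _≗_; refl; sym; trans; cong; cong₂; subst; setoid; module ≡-Reasoning)
import Relation.Binary.Reasoning.Setoid as SetoidReasoning
open import Relation.Nullary.Decidable using
  (Dec; yes; no; does; _×-dec_; map′; toWitness; dec-true; dec-false)
open import Relation.Nullary.Negation using (contradiction)

-- Polynomials and power series

infix 4 _≋_

-- _≈ₚ_ as a record: its two sides can then be inferred from a proof.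
record _≋_ (f g : Poly) : Set where
  constructor byCoeff
  field coeffs : f ≈ₚ g

open _≋_

≋-setoid : Setoid 0ℓ 0ℓ
≋-setoid = record
  { Carrier       = Poly
  ; _≈_           = _≋_
  ; isEquivalence = record
    { refl  = byCoeff λ _ → refl
    ; sym   = λ e → byCoeff λ m → sym (coeffs e m)
    ; trans = λ e e′ → byCoeff λ m → trans (coeffs e m) (coeffs e′ m)
    }
  }

open Setoid ≋-setoid using ()
  renaming (refl to ≋-refl; reflexive to ≋-reflexive; sym to ≋-sym; trans to ≋-trans)
module ≋-Reasoning = SetoidReasoning ≋-setoid

∷-cong : ∀ {a b f g} → a ≡ b → f ≋ g → a ∷ f ≋ b ∷ g
∷-cong a≡b f≋g .coeffs zero    = a≡b
∷-cong a≡b f≋g .coeffs (suc m) = coeffs f≋g m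

infix 4 _≈ₚ?_

_≈ₚ?_ : ∀ f g → Dec (f ≈ₚ g)
[]      ≈ₚ? []      = yes λ _ → refl
[]      ≈ₚ? (b ∷ g) = map′ (λ { (e , h) zero → e ; (e , h) (suc m) → h m })
  (λ h → h 0 , h ∘ suc) ((0ℤ ℤ.≟ b) ×-dec ([] ≈ₚ? g))
(a ∷ f) ≈ₚ? []      = map′ (λ { (e , h) zero → e ; (e , h) (suc m) → h m })
  (λ h → h 0 , h ∘ suc) ((a ℤ.≟ 0ℤ) ×-dec (f ≈ₚ? []))
(a ∷ f) ≈ₚ? (b ∷ g) = map′ (λ { (e , h) zero → e ; (e , h) (suc m) → h m })
  (λ h → h 0 , h ∘ suc) ((a ℤ.≟ b) ×-dec (f ≈ₚ? g))

coeff-⊕ : ∀ f g m → coeff (f ⊕ g) m ≡ coeff f m ℤ.+ coeff g m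
coeff-⊕ []      g       m       = sym (ℤ.+-identityˡ _)
coeff-⊕ (a ∷ f) []      m       = sym (ℤ.+-identityʳ _)
coeff-⊕ (a ∷ f) (b ∷ g) zero    = refl
coeff-⊕ (a ∷ f) (b ∷ g) (suc m) = coeff-⊕ f g m

⊕-cong : ∀ {f f′ g g′} → f ≋ f′ → g ≋ g′ → f ⊕ g ≋ f′ ⊕ g′
⊕-cong {f} {f′} {g} {g′} f≋ g≋ .coeffs m = begin
  coeff (f ⊕ g) m           ≡⟨ coeff-⊕ f g m ⟩
  coeff f m ℤ.+ coeff g m   ≡⟨ cong₂ ℤ._+_ (coeffs f≋ m) (coeffs g≋ m) ⟩
  coeff f′ m ℤ.+ coeff g′ m ≡⟨ coeff-⊕ f′ g′ m ⟨
  coeff (f′ ⊕ g′) m         ∎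
  where open ≡-Reasoning

⊕-congˡ : ∀ f {g g′} → g ≋ g′ → f ⊕ g ≋ f ⊕ g′
⊕-congˡ f = ⊕-cong (≋-refl {f})

⊕-comm : ∀ f g → f ⊕ g ≋ g ⊕ f
⊕-comm f g .coeffs m = begin
  coeff (f ⊕ g) m         ≡⟨ coeff-⊕ f g m ⟩
  coeff f m ℤ.+ coeff g m ≡⟨ ℤ.+-comm (coeff f m) _ ⟩
  coeff g m ℤ.+ coeff f m ≡⟨ coeff-⊕ g f m ⟨
  coeff (g ⊕ f) m         ∎
  where open ≡-Reasoning

⊕-assoc : ∀ f g h → (f ⊕ g) ⊕ h ≋ f ⊕ (g ⊕ h)
⊕-assoc f g h .coeffs m = begin
  coeff ((f ⊕ g) ⊕ h) m                     ≡⟨ coeff-⊕ (f ⊕ g) h m ⟩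
  coeff (f ⊕ g) m ℤ.+ coeff h m             ≡⟨ cong (ℤ._+ coeff h m) (coeff-⊕ f g m) ⟩
  (coeff f m ℤ.+ coeff g m) ℤ.+ coeff h m   ≡⟨ ℤ.+-assoc (coeff f m) _ _ ⟩
  coeff f m ℤ.+ (coeff g m ℤ.+ coeff h m)   ≡⟨ cong (ℤ._+_ (coeff f m)) (coeff-⊕ g h m) ⟨
  coeff f m ℤ.+ coeff (g ⊕ h) m             ≡⟨ coeff-⊕ f (g ⊕ h) m ⟨
  coeff (f ⊕ (g ⊕ h)) m                     ∎
  where open ≡-Reasoning

⊕-identityʳ : ∀ f → f ⊕ 0ₚ ≋ f
⊕-identityʳ []      = ≋-refl
⊕-identityʳ (a ∷ f) = ≋-refl

⊕-interchange : ∀ f g h k → (f ⊕ g) ⊕ (h ⊕ k) ≋ (f ⊕ h) ⊕ (g ⊕ k)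
⊕-interchange f g h k = begin
  (f ⊕ g) ⊕ (h ⊕ k) ≈⟨ ⊕-assoc f g (h ⊕ k) ⟩
  f ⊕ (g ⊕ (h ⊕ k)) ≈⟨ ⊕-congˡ f (≋-sym (⊕-assoc g h k)) ⟩
  f ⊕ ((g ⊕ h) ⊕ k) ≈⟨ ⊕-congˡ f (⊕-cong (⊕-comm g h) (≋-refl {k})) ⟩
  f ⊕ ((h ⊕ g) ⊕ k) ≈⟨ ⊕-congˡ f (⊕-assoc h g k) ⟩
  f ⊕ (h ⊕ (g ⊕ k)) ≈⟨ ⊕-assoc f h (g ⊕ k) ⟨
  (f ⊕ h) ⊕ (g ⊕ k) ∎
  where open ≋-Reasoning

-- Multiplication by a fixed polynomial and by a power of y both have this form, so one argument
-- moves either of them through finite sums.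
record IsLinear (φ : Poly → Poly) : Set where
  field
    φ-cong : ∀ {f g} → f ≋ g → φ f ≋ φ g
    φ-0    : φ 0ₚ ≋ 0ₚ
    φ-⊕    : ∀ f g → φ (f ⊕ g) ≋ φ f ⊕ φ g

coeff-scale : ∀ a f m → coeff (map (a ℤ.*_) f) m ≡ a ℤ.* coeff f m
coeff-scale a []      m       = sym (ℤ.*-zeroʳ a)
coeff-scale a (b ∷ f) zero    = refl
coeff-scale a (b ∷ f) (suc m) = coeff-scale a f m

scale-linear : ∀ a → IsLinear (map (a ℤ.*_))
scale-linear a = record
  { φ-cong = λ {f} {g} f≋g → byCoeff λ m →
      trans (coeff-scale a f m) (trans (cong (a ℤ.*_) (coeffs f≋g m)) (sym (coeff-scale a g m)))
  ; φ-0    = ≋-refl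
  ; φ-⊕    = λ f g → byCoeff λ m → begin
      coeff (map (a ℤ.*_) (f ⊕ g)) m
        ≡⟨ coeff-scale a (f ⊕ g) m ⟩
      a ℤ.* coeff (f ⊕ g) m
        ≡⟨ cong (a ℤ.*_) (coeff-⊕ f g m) ⟩
      a ℤ.* (coeff f m ℤ.+ coeff g m)
        ≡⟨ ℤ.*-distribˡ-+ a (coeff f m) (coeff g m) ⟩
      a ℤ.* coeff f m ℤ.+ a ℤ.* coeff g m
        ≡⟨ cong₂ ℤ._+_ (coeff-scale a f m) (coeff-scale a g m) ⟨
      coeff (map (a ℤ.*_) f) m ℤ.+ coeff (map (a ℤ.*_) g) m
        ≡⟨ coeff-⊕ (map (a ℤ.*_) f) (map (a ℤ.*_) g) m ⟨
      coeff (map (a ℤ.*_) f ⊕ map (a ℤ.*_) g) m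
        ∎
  }
  where open ≡-Reasoning

∘-linear : ∀ {φ ψ} → IsLinear φ → IsLinear ψ → IsLinear (φ ∘ ψ)
∘-linear {φ} {ψ} φ-lin ψ-lin = record
  { φ-cong = φ.φ-cong ∘ ψ.φ-cong
  ; φ-0    = ≋-trans (φ.φ-cong ψ.φ-0) φ.φ-0
  ; φ-⊕    = λ f g → ≋-trans (φ.φ-cong (ψ.φ-⊕ f g)) (φ.φ-⊕ (ψ f) (ψ g))
  }
  where
  module φ = IsLinear φ-lin
  module ψ = IsLinear ψ-lin

⊕-linear : ∀ {φ ψ} → IsLinear φ → IsLinear ψ → IsLinear (λ f → φ f ⊕ ψ f)
⊕-linear {φ} {ψ} φ-lin ψ-lin = record
  { φ-cong = λ f≈g → ⊕-cong (φ.φ-cong f≈g) (ψ.φ-cong f≈g)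
  ; φ-0    = ⊕-cong φ.φ-0 ψ.φ-0
  ; φ-⊕    = λ f g → ≋-trans
      (⊕-cong (φ.φ-⊕ f g) (ψ.φ-⊕ f g)) (⊕-interchange (φ f) (φ g) (ψ f) (ψ g))
  }
  where
  module φ = IsLinear φ-lin
  module ψ = IsLinear ψ-lin

0∷-linear : IsLinear (0ℤ ∷_)
0∷-linear = record
  { φ-cong = ∷-cong refl
  ; φ-0    = byCoeff λ { zero → refl ; (suc _) → refl }
  ; φ-⊕    = λ f g → ≋-refl
  }

⊗-linear : ∀ f → IsLinear (f ⊗_)
⊗-linear [] = record
  { φ-cong = λ _ → ≋-refl ; φ-0 = ≋-refl ; φ-⊕ = λ _ _ → ≋-refl }
⊗-linear (a ∷ f) = ⊕-linear (scale-linear a) (∘-linear 0∷-linear (⊗-linear f))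

-- Multiplication by y^m. The monomial `a y^ m` is by definition `shift m` of the constant `a`.
shift : ℕ → Poly → Poly
shift m f = replicate m 0ℤ ++ f

shift-linear : ∀ m → IsLinear (shift m)
shift-linear zero    = record { φ-cong = λ f≋g → f≋g ; φ-0 = ≋-refl ; φ-⊕ = λ _ _ → ≋-refl }
shift-linear (suc m) = ∘-linear 0∷-linear (shift-linear m)

shift-+ : ∀ m n f → shift (m + n) f ≡ shift m (shift n f)
shift-+ zero    n f = refl
shift-+ (suc m) n f = cong (0ℤ ∷_) (shift-+ m n f)

⊗-0∷ : ∀ f g → f ⊗ (0ℤ ∷ g) ≋ 0ℤ ∷ f ⊗ g
⊗-0∷ []      g = byCoeff λ { zero → refl ; (suc _) → refl }
⊗-0∷ (a ∷ f) g = begin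
  (a ℤ.* 0ℤ ℤ.+ 0ℤ) ∷ map (a ℤ.*_) g ⊕ f ⊗ (0ℤ ∷ g)
    ≈⟨ ∷-cong (trans (ℤ.+-identityʳ _) (ℤ.*-zeroʳ a))
         (⊕-congˡ (map (a ℤ.*_) g) (⊗-0∷ f g)) ⟩
  0ℤ ∷ map (a ℤ.*_) g ⊕ (0ℤ ∷ f ⊗ g)
    ∎
  where open ≋-Reasoning

⊗-shift : ∀ m f g → f ⊗ shift m g ≋ shift m (f ⊗ g)
⊗-shift zero    f g = ≋-refl
⊗-shift (suc m) f g = ≋-trans (⊗-0∷ f (shift m g)) (∷-cong refl (⊗-shift m f g))

module _ {ℓ} {A : Set ℓ} where

  Σ-cong : ∀ {f g : A → Poly} → (∀ x → f x ≋ g x) → ∀ xs → Σₚ (map f xs) ≋ Σₚ (map g xs)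
  Σ-cong f≈g []       = ≋-refl
  Σ-cong f≈g (x ∷ xs) = ⊕-cong (f≈g x) (Σ-cong f≈g xs)

  Σ-linear : ∀ {φ} → IsLinear φ → ∀ (f : A → Poly) xs → φ (Σₚ (map f xs)) ≋ Σₚ (map (φ ∘ f) xs)
  Σ-linear φ-lin f []       = IsLinear.φ-0 φ-lin
  Σ-linear {φ} φ-lin f (x ∷ xs) = ≋-trans
    (IsLinear.φ-⊕ φ-lin (f x) _) (⊕-congˡ (φ (f x)) (Σ-linear φ-lin f xs))

  Σ-⊕ : ∀ (f g : A → Poly) xs → Σₚ (map (λ x → f x ⊕ g x) xs) ≋ Σₚ (map f xs) ⊕ Σₚ (map g xs)
  Σ-⊕ f g []       = ≋-refl
  Σ-⊕ f g (x ∷ xs) = ≋-trans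
    (⊕-congˡ (f x ⊕ g x) (Σ-⊕ f g xs))
    (⊕-interchange (f x) (g x) (Σₚ (map f xs)) (Σₚ (map g xs)))

  Σ-zero : ∀ {f : A → Poly} → (∀ x → f x ≋ 0ₚ) → ∀ xs → Σₚ (map f xs) ≋ 0ₚ
  Σ-zero f≈0 []       = ≋-refl
  Σ-zero f≈0 (x ∷ xs) = ⊕-cong (f≈0 x) (Σ-zero f≈0 xs)

  Σ-↭ : ∀ (f : A → Poly) {xs ys} → xs ↭ ys → Σₚ (map f xs) ≋ Σₚ (map f ys)
  Σ-↭ f Perm.refl = ≋-refl
  Σ-↭ f (Perm.prep x p) = ⊕-congˡ (f x) (Σ-↭ f p)
  Σ-↭ f (Perm.swap {xs} {ys} x y p) = begin
    f x ⊕ (f y ⊕ Σₚ (map f xs)) ≈⟨ ⊕-assoc (f x) (f y) _ ⟨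
    (f x ⊕ f y) ⊕ Σₚ (map f xs) ≈⟨ ⊕-cong (⊕-comm (f x) (f y)) (Σ-↭ f p) ⟩
    (f y ⊕ f x) ⊕ Σₚ (map f ys) ≈⟨ ⊕-assoc (f y) (f x) _ ⟩
    f y ⊕ (f x ⊕ Σₚ (map f ys)) ∎
    where open ≋-Reasoning
  Σ-↭ f (Perm.trans {xs} p q) = ≋-trans (Σ-↭ f p) (Σ-↭ f q)

Σₚ-++ : ∀ fs gs → Σₚ (fs ++ gs) ≋ Σₚ fs ⊕ Σₚ gs
Σₚ-++ []       gs = ≋-refl
Σₚ-++ (f ∷ fs) gs = ≋-trans
  (⊕-congˡ f (Σₚ-++ fs gs)) (≋-sym (⊕-assoc f (Σₚ fs) (Σₚ gs)))

Σ-cartesianProductWith : ∀ {A B C : Set} (f : C → Poly) (g : A → B → C) xs ys →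
  Σₚ (map f (cartesianProductWith g xs ys)) ≋ Σₚ (map (λ x → Σₚ (map (λ y → f (g x y)) ys)) xs)
Σ-cartesianProductWith f g []       ys = ≋-refl
Σ-cartesianProductWith f g (x ∷ xs) ys = begin
  Σₚ (map f (map (g x) ys ++ cartesianProductWith g xs ys))
    ≡⟨ cong Σₚ (List.map-++ f (map (g x) ys) _) ⟩
  Σₚ (map f (map (g x) ys) ++ map f (cartesianProductWith g xs ys))
    ≈⟨ Σₚ-++ (map f (map (g x) ys)) _ ⟩
  Σₚ (map f (map (g x) ys)) ⊕ Σₚ (map f (cartesianProductWith g xs ys))
    ≡⟨ cong (λ fs → Σₚ fs ⊕ _) (List.map-∘ ys) ⟨
  Σₚ (map (f ∘ g x) ys) ⊕ Σₚ (map f (cartesianProductWith g xs ys))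
    ≈⟨ ⊕-congˡ (Σₚ (map (f ∘ g x) ys)) (Σ-cartesianProductWith f g xs ys) ⟩
  Σₚ (map (λ y → f (g x y)) ys) ⊕ Σₚ (map (λ x → Σₚ (map (λ y → f (g x y)) ys)) xs)
    ∎
  where open ≋-Reasoning

-- Coefficient `n` of a product reads only indices up to `n`. The bound in the hypothesis later
-- allows `W` to be replaced by finitely many tables.
⊛-cong : ∀ D {F G} n → (∀ k → k ≤ n → F k ≋ G k) → (D ⊛ F) n ≋ (D ⊛ G) n
⊛-cong D n F≈G =
  Σ-cong (λ i → IsLinear.φ-cong (⊗-linear (D i)) (F≈G (n ∸ i) (ℕ.m∸n≤m n i))) (upTo (suc n))

⊛-shift : ∀ D F m n → (D ⊛ (shift m ∘ F)) n ≋ shift m ((D ⊛ F) n)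
⊛-shift D F m n = ≋-trans
  (Σ-cong (λ i → ⊗-shift m (D i) (F (n ∸ i))) (upTo (suc n)))
  (≋-sym (Σ-linear (shift-linear m) (λ i → D i ⊗ F (n ∸ i)) (upTo (suc n))))

⊛-Σ : ∀ {A : Set} D (F : A → Series) xs n →
  (D ⊛ (λ k → Σₚ (map (λ x → F x k) xs))) n ≋ Σₚ (map (λ x → (D ⊛ F x) n) xs)
⊛-Σ D F []       n = Σ-zero (λ i → IsLinear.φ-0 (⊗-linear (D i))) (upTo (suc n))
⊛-Σ D F (x ∷ xs) n = begin
  (D ⊛ (λ k → F x k ⊕ S k)) n
    ≈⟨ Σ-cong (λ i → IsLinear.φ-⊕ (⊗-linear (D i)) (F x (n ∸ i)) _) (upTo (suc n)) ⟩
  Σₚ (map (λ i → D i ⊗ F x (n ∸ i) ⊕ D i ⊗ S (n ∸ i)) (upTo (suc n)))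
    ≈⟨ Σ-⊕ (λ i → D i ⊗ F x (n ∸ i)) (λ i → D i ⊗ S (n ∸ i)) (upTo (suc n)) ⟩
  (D ⊛ F x) n ⊕ (D ⊛ S) n
    ≈⟨ ⊕-congˡ ((D ⊛ F x) n) (⊛-Σ D F xs n) ⟩
  (D ⊛ F x) n ⊕ Σₚ (map (λ x → (D ⊛ F x) n) xs)
    ∎
  where
  open ≋-Reasoning
  S : Series
  S k = Σₚ (map (λ x → F x k) xs)

-- A denominator of degree at most 7 in x leaves eight terms, which read `F` at the indices m+1,
-- ..., m+8. Index 0 is never reached, hence the `suc` on the right.
⊛-truncate : ∀ D F → (∀ i → D (8 + i) ≡ 0ₚ) → ∀ m →
  (D ⊛ F) (8 + m) ≋ (D ⊛ (λ k → F (suc k + m))) 7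
⊛-truncate D F D≡0 m = begin
  Σₚ (map term (upTo (9 + m)))
    ≈⟨ Σₚ-++ (map term (upTo 8)) (map term (applyUpTo (8 +_) (suc m))) ⟩
  Σₚ (map term (upTo 8)) ⊕ Σₚ (map term (applyUpTo (8 +_) (suc m)))
    ≈⟨ ⊕-congˡ (Σₚ (map term (upTo 8))) (vanish (8 +_) D≡0 (suc m)) ⟩
  Σₚ (map term (upTo 8)) ⊕ 0ₚ
    ≈⟨ ⊕-identityʳ (Σₚ (map term (upTo 8))) ⟩
  -- For each numeral i up to 7, `8 + m ∸ i` and `suc (7 ∸ i) + m` compute to the same index, so
  -- this is already the right-hand side.
  Σₚ (map term (upTo 8))
    ∎
  where
  open ≋-Reasoning
  term : ℕ → Poly
  term i = D i ⊗ F (8 + m ∸ i)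

  vanish : ∀ f → (∀ i → D (f i) ≡ 0ₚ) → ∀ n → Σₚ (map term (applyUpTo f n)) ≋ 0ₚ
  vanish f D≡0 zero    = ≋-refl
  vanish f D≡0 (suc n) rewrite D≡0 0 = vanish (f ∘ suc) (D≡0 ∘ suc) n

module _ {S C : Set} {cs : List C} {δ : S → C → ℕ} {next : S → C → S} {W : S → Series}
  (W-suc : ∀ s n → W s (suc n) ≡ Σₚ (map (λ c → shift (δ s c) (W (next s c) n)) cs)) where

  -- Induction on `m` for all states at once: one step of the recursion writes the series at offset
  -- m+1 as a sum of multiples by powers of y of series at offset m, and convolution with `D` is
  -- linear.
  recurrence-propagates : ∀ D n → (∀ s → (D ⊛ W s) n ≋ 0ₚ) →
    ∀ m s → (D ⊛ (λ k → W s (k + m))) n ≋ 0ₚ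
  recurrence-propagates D n base zero    s = ≋-trans
    (⊛-cong D n λ k _ → ≋-reflexive (cong (W s) (ℕ.+-identityʳ k))) (base s)
  recurrence-propagates D n base (suc m) s = begin
    (D ⊛ (λ k → W s (k + suc m))) n
      ≈⟨ ⊛-cong D n (λ k _ →
           ≋-reflexive (trans (cong (W s) (ℕ.+-suc k m)) (W-suc s (k + m)))) ⟩
    (D ⊛ (λ k → Σₚ (map (λ c → shift (δ s c) (W (next s c) (k + m))) cs))) n
      ≈⟨ ⊛-Σ D (λ c k → shift (δ s c) (W (next s c) (k + m))) cs n ⟩
    Σₚ (map (λ c → (D ⊛ (λ k → shift (δ s c) (W (next s c) (k + m)))) n) cs)
      ≈⟨ Σ-zero zeros cs ⟩
    0ₚ
      ∎
    where
    open ≋-Reasoning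
    zeros : ∀ c → (D ⊛ (λ k → shift (δ s c) (W (next s c) (k + m)))) n ≋ 0ₚ
    zeros c = begin
      (D ⊛ (λ k → shift (δ s c) (W (next s c) (k + m)))) n
        ≈⟨ ⊛-shift D (λ k → W (next s c) (k + m)) (δ s c) n ⟩
      shift (δ s c) ((D ⊛ (λ k → W (next s c) (k + m))) n)
        ≈⟨ IsLinear.φ-cong (shift-linear (δ s c)) (recurrence-propagates D n base m (next s c)) ⟩
      shift (δ s c) 0ₚ
        ≈⟨ IsLinear.φ-0 (shift-linear (δ s c)) ⟩
      0ₚ
        ∎

-- The transfer matrix

-- The tail is the outer index, so a sum over words of length n+1 splits into sums over the newest
-- letter for each fixed earlier word.
words : ∀ {A : Set} → List A → ∀ n → List (Vec A n)
words xs zero    = [] ∷ []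
words xs (suc n) = cartesianProductWith (flip _∷_) (words xs n) xs

Column : Set
Column = Vec (Fin 2) 4

opaque
  -- Opaque, so that general arguments treat the list as a variable. It is unfolded only for the
  -- finite checks and to show that it contains every column exactly once.
  columns : List Column
  columns = words (List.allFin 2) 4

-- Pattern m describes an equivalence relation on Fin m: i and j are related when they have the
-- same label.
Pattern : ℕ → Set
Pattern = Vec ℕ

relabel : ℕ → ℕ → ℕ → ℕ
relabel a b x = if x ≡ᵇ a then b else x

Edge : ℕ → Set
Edge m = Fin m × Fin m

mergePattern : ∀ {m} → Pattern m → Edge m → Pattern m
mergePattern t (u , v) = Vec.map (relabel (lookup t u) (lookup t v)) t

mergePatterns : ∀ {m} → Pattern m → List (Edge m) → Pattern m
mergePatterns = List.foldl mergePattern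

-- Only edges that join two different classes at their turn are counted, so this is the drop in the
-- number of classes.
merges : ∀ {m} → Pattern m → List (Edge m) → ℕ
merges t []       = 0
merges t (e@(u , v) ∷ es) =
  (if lookup t u ≡ᵇ lookup t v then 0 else 1) + merges (mergePattern t e) es

monochromatic : ∀ {m} → Vec (Fin 2) m → List (Edge m) → List (Edge m)
monochromatic c = filter λ (u , v) → lookup c u Fin.≟ lookup c v

-- Vertices 0–3 are those of the new column, starting with the center; 4–7 those of the column
-- it is attached to.
starEdges : ∀ m → List (Edge (4 + m))
starEdges _ = (0F , 1F) ∷ (0F , 2F) ∷ (0F , 3F) ∷ []

pathEdges : List (Edge 8)
pathEdges = (0F , 4F) ∷ (1F , 5F) ∷ (2F , 6F) ∷ (3F , 7F) ∷ []

discrete : Pattern 4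
discrete = 0 ∷ 1 ∷ 2 ∷ 3 ∷ []

-- The restricted growth strings of length 4: the labels used are 0, …, max.
partitions : Vec (Pattern 4) 15
partitions =
    (0 ∷ 0 ∷ 0 ∷ 0 ∷ []) ∷ (0 ∷ 0 ∷ 0 ∷ 1 ∷ []) ∷ (0 ∷ 0 ∷ 1 ∷ 0 ∷ [])
  ∷ (0 ∷ 0 ∷ 1 ∷ 1 ∷ []) ∷ (0 ∷ 0 ∷ 1 ∷ 2 ∷ []) ∷ (0 ∷ 1 ∷ 0 ∷ 0 ∷ [])
  ∷ (0 ∷ 1 ∷ 0 ∷ 1 ∷ []) ∷ (0 ∷ 1 ∷ 0 ∷ 2 ∷ []) ∷ (0 ∷ 1 ∷ 1 ∷ 0 ∷ [])
  ∷ (0 ∷ 1 ∷ 1 ∷ 1 ∷ []) ∷ (0 ∷ 1 ∷ 1 ∷ 2 ∷ []) ∷ (0 ∷ 1 ∷ 2 ∷ 0 ∷ [])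
  ∷ (0 ∷ 1 ∷ 2 ∷ 1 ∷ []) ∷ (0 ∷ 1 ∷ 2 ∷ 2 ∷ []) ∷ (0 ∷ 1 ∷ 2 ∷ 3 ∷ [])
  ∷ []

State : Set
State = Fin 30

-- The center is vertex 0 and has label 0 in a restricted growth string. A leaf is adjacent to the
-- center, so it shares the color exactly when it shares the label.
withCenter : Fin 2 → Pattern 4 → Column × Pattern 4
withCenter a t = Vec.map (λ x → if x ≡ᵇ 0 then a else opposite a) t , t

opaque
  stateTable : Vec (Column × Pattern 4) 30
  stateTable = Vec.map (withCenter 0F) partitions Vec.++ Vec.map (withCenter 1F) partitions

column : State → Column
column s = proj₁ (lookup stateTable s)

connectivity : State → Pattern 4
connectivity s = proj₂ (lookup stateTable s)

-- The number of classes: one more than the largest label of a restricted growth string.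
active : State → ℕ
active s = suc (Vec.foldr (λ _ → ℕ) _⊔_ 0 (connectivity s))

-- Relabelling does not preserve restricted growth strings, so patterns are compared by the relation
-- they describe. Boolean equations make this decidable by evaluation.
SamePattern : Pattern 4 → Pattern 4 → Set
SamePattern t t′ = ∀ i j → (lookup t i ≡ᵇ lookup t j) ≡ (lookup t′ i ≡ᵇ lookup t′ j)

samePattern? : ∀ t t′ → Dec (SamePattern t t′)
samePattern? t t′ = Fin.all? λ i → Fin.all? λ j →
  (lookup t i ≡ᵇ lookup t j) Bool.≟ (lookup t′ i ≡ᵇ lookup t′ j)

_≟ᶜ_ : (c d : Column) → Dec (c ≡ d)
_≟ᶜ_ = Vec.≡-dec Fin._≟_

-- If nothing is found, the result is the last index.
search : ∀ {A : Set} {n} → (A → Bool) → Vec A (suc n) → Fin (suc n)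
search f (x ∷ [])         = zero
search f (x ∷ xs@(_ ∷ _)) = if f x then zero else suc (search f xs)

opaque
  findState : Column → Pattern 4 → State
  findState c t = search (λ (d , t′) → does (c ≟ᶜ d) ∧ does (samePattern? t t′)) stateTable

Matches : Column → Pattern 4 → State → Set
Matches c t s = c ≡ column s × SamePattern t (connectivity s)

matches? : ∀ c t s → Dec (Matches c t s)
matches? c t s = (c ≟ᶜ column s) ×-dec samePattern? t (connectivity s)

initPattern : Column → Pattern 4
initPattern c = mergePatterns discrete (monochromatic c (starEdges 0))

init : Column → State
init c = findState c (initPattern c)

-- Adding 4 keeps the labels of the old column apart from the labels 0-3 of the new one.
stepPattern₀ : State → Pattern 8
stepPattern₀ s = discrete Vec.++ Vec.map (4 +_) (connectivity s)

stepEdges : State → Column → List (Edge 8)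
stepEdges s c = monochromatic (c Vec.++ column s) (starEdges 4 List.++ pathEdges)

stepPattern : State → Column → Pattern 8
stepPattern s c = mergePatterns (stepPattern₀ s) (stepEdges s c)

front : Pattern 8 → Pattern 4
front t = tabulate λ i → lookup t (i ↑ˡ 4)

step : State → Column → State
step s c = findState c (front (stepPattern s c))

stepMerges : State → Column → ℕ
stepMerges s c = merges (stepPattern₀ s) (stepEdges s c)

-- The components of s and the four new vertices, after the merges, either meet the new column or
-- have ended.  By stepCorrect the subtraction is not truncated.
δ : State → Column → ℕ
δ s c = active s + 4 ∸ (stepMerges s c + active (step s c))

-- `findState` returns a default when nothing matches and `δ` uses truncated subtraction. These are
-- the two facts that exclude both defects.
StepCorrect : State → Column → Set
StepCorrect s c = Matches c (front (stepPattern s c)) (step s c) ×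
  δ s c + (stepMerges s c + active (step s c)) ≡ active s + 4

stepCorrect? : ∀ s c → Dec (StepCorrect s c)
stepCorrect? s c = matches? c (front (stepPattern s c)) (step s c) ×-dec
  (δ s c + (stepMerges s c + active (step s c)) ℕ.≟ active s + 4)

InitCorrect : Column → Set
InitCorrect c = Matches c (initPattern c) (init c) ×
  merges discrete (monochromatic c (starEdges 0)) + active (init c) ≡ 4

initCorrect? : ∀ c → Dec (InitCorrect c)
initCorrect? c = matches? c (initPattern c) (init c) ×-dec
  (merges discrete (monochromatic c (starEdges 0)) + active (init c) ℕ.≟ 4)

opaque
  unfolding columns stateTable findState

  -- The decision procedure is evaluated on all 30 · 16 transitions.
  stepCorrect : ∀ s → All (StepCorrect s) columns
  stepCorrect = toWitness {a? = Fin.all? λ s → All.all? (stepCorrect? s) columns} _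

  initCorrect : All InitCorrect columns
  initCorrect = toWitness {a? = All.all? initCorrect? columns} _

-- The weights of the states and their recurrence

extend : Vec Poly 30 → Vec Poly 30
extend w = tabulate λ s → Σₚ (map (λ c → shift (δ s c) (lookup w (step s c))) columns)

initialWeights : Vec Poly 30
initialWeights = tabulate λ s → 1ℤ y^ active s

opaque
  W : State → Series
  W s zero    = 1ℤ y^ active s
  W s (suc n) = Σₚ (map (λ c → shift (δ s c) (W (step s c) n)) columns)

  W-zero : ∀ s → W s 0 ≡ 1ℤ y^ active s
  W-zero s = refl

  W-suc : ∀ s n → W s (suc n) ≡ Σₚ (map (λ c → shift (δ s c) (W (step s c) n)) columns)
  W-suc s n = refl

-- The first column is placed by `init`, so of n+1 columns only n remain to be added by the
-- recursion.
total : (State → Series) → Series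
total F zero    = 0ₚ
total F (suc n) = Σₚ (map (λ c → F (init c) n) columns)

-- For the computation the values of W are read off a list of tables: the recursion defining W
-- would visit 16ⁿ columns.
at : List (Vec Poly 30) → State → Series
at []       s _       = 0ₚ
at (w ∷ ws) s zero    = lookup w s
at (w ∷ ws) s (suc n) = at ws s n

-- The offset `m` serves the induction, which advances the starting table. The bound `n < k` keeps
-- clear of the default value past the end of the list.
at-iterate : ∀ {w m} → (∀ s → lookup w s ≡ W s m) →
  ∀ {n k} → n < k → ∀ s → at (iterate extend w k) s n ≡ W s (n + m)
at-iterate         w≡W {zero}  {suc k} _         s = w≡W s
at-iterate {w} {m} w≡W {suc n} {suc k} (s<s n<k) s =
  trans (at-iterate extended n<k s) (cong (W s) (ℕ.+-suc n m))
  where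
  extended : ∀ s → lookup (extend w) s ≡ W s (suc m)
  extended s = begin
    lookup (extend w) s
      ≡⟨ Vec.lookup∘tabulate
           (λ s → Σₚ (map (λ c → shift (δ s c) (lookup w (step s c))) columns)) s ⟩
    Σₚ (map (λ c → shift (δ s c) (lookup w (step s c))) columns)
      ≡⟨ cong Σₚ (List.map-cong (λ c → cong (shift (δ s c)) (w≡W (step s c))) columns) ⟩
    Σₚ (map (λ c → shift (δ s c) (W (step s c) m)) columns)
      ≡⟨ W-suc s m ⟨
    W s (suc m)
      ∎
    where open ≡-Reasoning

opaque
  -- The weights for n = 0, ..., 7. The recurrence at index 7 and the comparison with `p` up to x⁷
  -- read nothing beyond these.
  tables : List (Vec Poly 30)
  tables = iterate extend initialWeights 8

  at-tables : ∀ {n} → n < 8 → ∀ s → at tables s n ≡ W s n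
  at-tables {n} n<8 s = trans
    (at-iterate (λ s → trans (Vec.lookup∘tabulate (λ s → 1ℤ y^ active s) s) (sym (W-zero s))) n<8 s)
    (cong (W s) (ℕ.+-identityʳ n))

SatisfiesRecurrence : List (Vec Poly 30) → Set
SatisfiesRecurrence ws = (∀ s → (q ⊛ at ws s) 7 ≈ₚ 0ₚ) ×
  (∀ (n : Fin 8) → (q ⊛ total (at ws)) (toℕ n) ≈ₚ p (toℕ n))

satisfiesRecurrence? : ∀ ws → Dec (SatisfiesRecurrence ws)
satisfiesRecurrence? ws = Fin.all? (λ s → (q ⊛ at ws s) 7 ≈ₚ? 0ₚ) ×-dec
  Fin.all? (λ n → (q ⊛ total (at ws)) (toℕ n) ≈ₚ? p (toℕ n))

opaque
  unfolding columns stateTable findState tables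

  tables-recurrence : SatisfiesRecurrence tables
  tables-recurrence = toWitness {a? = satisfiesRecurrence? tables} _

W-recurrence : ∀ m s → (q ⊛ (λ k → W s (k + m))) 7 ≋ 0ₚ
W-recurrence = recurrence-propagates {cs = columns} {δ} {step} {W} W-suc q 7 λ s → ≋-trans
  (⊛-cong q 7 λ k k≤7 → ≋-reflexive (sym (at-tables (s≤s k≤7) s)))
  (byCoeff (proj₁ tables-recurrence s))

total-small : ∀ n → n < 8 → (q ⊛ total W) n ≋ p n
total-small n n<8 = ≋-trans (⊛-cong q n total-tables)
  (byCoeff (subst (λ n → (q ⊛ total (at tables)) n ≈ₚ p n) (Fin.toℕ-fromℕ< n<8)
    (proj₂ tables-recurrence (fromℕ< n<8))))
  where
  total-tables : ∀ k → k ≤ n → total W k ≋ total (at tables) k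
  total-tables zero    _   = ≋-refl
  total-tables (suc k) k<n =
    Σ-cong (λ c → ≋-reflexive (sym (at-tables (ℕ.<-trans k<n n<8) (init c)))) columns

-- After truncation only positive indices of `total W` remain. There it is a sum of series
-- `W (init c)`, each of which satisfies the recurrence.
total-large : ∀ m → (q ⊛ total W) (8 + m) ≋ 0ₚ
total-large m = begin
  (q ⊛ total W) (8 + m)
    ≈⟨ ⊛-truncate q (total W) (λ _ → refl) m ⟩
  (q ⊛ (λ k → Σₚ (map (λ c → W (init c) (k + m)) columns))) 7
    ≈⟨ ⊛-Σ q (λ c k → W (init c) (k + m)) columns 7 ⟩
  Σₚ (map (λ c → (q ⊛ (λ k → W (init c) (k + m))) 7) columns)
    ≈⟨ Σ-zero (λ c → W-recurrence m (init c)) columns ⟩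
  0ₚ
    ∎
  where open ≋-Reasoning

total-series : q ⊛ total W ≈ₛ p
total-series n with n ℕ.<? 8
... | yes n<8 = coeffs (total-small n n<8)
... | no n≮8 with m , refl ← ℕ.m≤n⇒∃[o]m+o≡n (ℕ.≮⇒≥ n≮8) = coeffs (total-large m)

-- Labellings by component

-- The common interface of `relabel` on numeric labels and of the quotient map on `Fin k`, through
-- which computed patterns are compared with actual components.
record Glues {A B : Set} (f : A → B) (a b : A) : Set where
  field
    glued : f a ≡ f b
    only  : ∀ {x y} → f x ≡ f y → x ≡ y ⊎ (x ≡ a × y ≡ b) ⊎ (x ≡ b × y ≡ a)

-- A pattern and a labelling use unrelated labels; what they share is which indices they identify.
record SameKernel {I A B : Set} (f : I → A) (g : I → B) : Set where
  field
    to   : ∀ {i j} → f i ≡ f j → g i ≡ g j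
    from : ∀ {i j} → g i ≡ g j → f i ≡ f j

-- The kernel after gluing depends only on the kernel before it and on the indices `u` and `v`.
glue-sameKernel : ∀ {I A A′ B B′ : Set} {f : I → A} {g : I → B} {h : A → A′} {k : B → B′} {u v} →
  Glues h (f u) (f v) → Glues k (g u) (g v) → SameKernel f g → SameKernel (h ∘ f) (k ∘ g)
glue-sameKernel {f = f} {g} {h} {k} {u} {v} hGlues kGlues same = record
  { to = λ e → case₁ (Glues.only hGlues e) ; from = λ e → case₂ (Glues.only kGlues e) }
  where
  open SameKernel same
  case₁ : ∀ {i j} → f i ≡ f j ⊎ (f i ≡ f u × f j ≡ f v) ⊎ (f i ≡ f v × f j ≡ f u) →
    k (g i) ≡ k (g j)
  case₁ (inj₁ e)              = cong k (to e)
  case₁ (inj₂ (inj₁ (e , e′))) =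
    trans (cong k (to e)) (trans (Glues.glued kGlues) (cong k (sym (to e′))))
  case₁ (inj₂ (inj₂ (e , e′))) =
    trans (cong k (to e)) (trans (sym (Glues.glued kGlues)) (cong k (sym (to e′))))
  case₂ : ∀ {i j} → g i ≡ g j ⊎ (g i ≡ g u × g j ≡ g v) ⊎ (g i ≡ g v × g j ≡ g u) →
    h (f i) ≡ h (f j)
  case₂ (inj₁ e)              = cong h (from e)
  case₂ (inj₂ (inj₁ (e , e′))) =
    trans (cong h (from e)) (trans (Glues.glued hGlues) (cong h (sym (from e′))))
  case₂ (inj₂ (inj₂ (e , e′))) =
    trans (cong h (from e)) (trans (sym (Glues.glued hGlues)) (cong h (sym (from e′))))

module _ {I A B : Set} {f f′ : I → A} {g g′ : I → B} where

  sameKernel-cong : (∀ i → f i ≡ f′ i) → (∀ i → g i ≡ g′ i) → SameKernel f g → SameKernel f′ g′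
  sameKernel-cong f≗f′ g≗g′ same = record
    { to   = λ {i} {j} e →
        trans (sym (g≗g′ i)) (trans (to (trans (f≗f′ i) (trans e (sym (f≗f′ j))))) (g≗g′ j))
    ; from = λ {i} {j} e →
        trans (sym (f≗f′ i)) (trans (from (trans (g≗g′ i) (trans e (sym (g≗g′ j))))) (f≗f′ j))
    }
    where open SameKernel same

sameKernel-∘ : ∀ {J I A B : Set} {f : I → A} {g : I → B} (h : J → I) →
  SameKernel f g → SameKernel (f ∘ h) (g ∘ h)
sameKernel-∘ h same = record { to = to ; from = from }
  where open SameKernel same

sameKernel-trans : ∀ {I A B C : Set} {f : I → A} {g : I → B} {h : I → C} →
  SameKernel f g → SameKernel g h → SameKernel f h
sameKernel-trans fg gh = record { to = G.to ∘ F.to ; from = F.from ∘ G.from }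
  where
  module F = SameKernel fg
  module G = SameKernel gh

sameKernel-⊎ : ∀ {I J A B : Set} {f : I → A} {f′ : J → A} {g : I → B} {g′ : J → B} →
  (∀ i j → f i ≢ f′ j) → (∀ i j → g i ≢ g′ j) → SameKernel f g → SameKernel f′ g′ →
  SameKernel [ f , f′ ]′ [ g , g′ ]′
sameKernel-⊎ f#f′ g#g′ same same′ = record
  { to   = λ { {inj₁ _} {inj₁ _} e → S.to e
             ; {inj₁ i} {inj₂ j} e → contradiction e (f#f′ i j)
             ; {inj₂ j} {inj₁ i} e → contradiction (sym e) (f#f′ i j)
             ; {inj₂ _} {inj₂ _} e → S′.to e }
  ; from = λ { {inj₁ _} {inj₁ _} e → S.from e
             ; {inj₁ i} {inj₂ j} e → contradiction e (g#g′ i j)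
             ; {inj₂ j} {inj₁ i} e → contradiction (sym e) (g#g′ i j)
             ; {inj₂ _} {inj₂ _} e → S′.from e }
  }
  where
  module S  = SameKernel same
  module S′ = SameKernel same′

relabel-≡ : ∀ a b → relabel a b a ≡ b
relabel-≡ a b = cong (if_then b else a) (dec-true (a ℕ.≟ a) refl)

relabel-≢ : ∀ a b {x} → x ≢ a → relabel a b x ≡ x
relabel-≢ a b {x} x≢a = cong (if_then b else x) (dec-false (x ℕ.≟ a) x≢a)

relabel-glues : ∀ a b → Glues (relabel a b) a b
relabel-glues a b = record { glued = glued ; only = only }
  where
  glued : relabel a b a ≡ relabel a b b
  glued with b ℕ.≟ a
  ... | yes refl = refl
  ... | no b≢a   = trans (relabel-≡ a b) (sym (relabel-≢ a b b≢a))

  only : ∀ {x y} → relabel a b x ≡ relabel a b y → x ≡ y ⊎ (x ≡ a × y ≡ b) ⊎ (x ≡ b × y ≡ a)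
  only {x} {y} e with x ℕ.≟ a | y ℕ.≟ a
  ... | yes refl | yes refl = inj₁ refl
  ... | yes refl | no y≢a   =
    inj₂ (inj₁ (refl , trans (sym (relabel-≢ a b y≢a)) (trans (sym e) (relabel-≡ a b))))
  ... | no x≢a   | yes refl =
    inj₂ (inj₂ (trans (sym (relabel-≢ a b x≢a)) (trans e (relabel-≡ a b)) , refl))
  ... | no x≢a   | no y≢a   =
    inj₁ (trans (sym (relabel-≢ a b x≢a)) (trans e (relabel-≢ a b y≢a)))

record Quotient {k : ℕ} (a b : Fin k) : Set where
  field
    size    : ℕ
    class   : Fin k → Fin size
    glues   : Glues class a b
    member  : ∀ j → ∃ λ i → class i ≡ j
    size-≡  : a ≡ b → k ≡ size
    size-≢  : a ≢ b → k ≡ suc size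

identify : ∀ {k} (a b : Fin k) → Quotient a b
identify {suc k} a b with a Fin.≟ b
... | yes a≡b = record
  { size   = suc k
  ; class  = id
  ; glues  = record { glued = a≡b ; only = inj₁ }
  ; member = λ j → j , refl
  ; size-≡ = λ _ → refl
  ; size-≢ = contradiction a≡b
  }
... | no a≢b = record
  { size   = k
  ; class  = class
  ; glues  = record { glued = glued ; only = only }
  ; member = λ j → punchIn a j , class-punchIn j
  ; size-≡ = λ a≡b → contradiction a≡b a≢b
  ; size-≢ = λ _ → refl
  }
  where
  class : Fin (suc k) → Fin k
  class x with a Fin.≟ x
  -- The removed point `a` takes the image of `b`.
  ... | yes _  = punchOut a≢b
  ... | no a≢x = punchOut a≢x

  class-punchIn : ∀ j → class (punchIn a j) ≡ j
  class-punchIn j with a Fin.≟ punchIn a j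
  ... | yes e = contradiction (sym e) (Fin.punchInᵢ≢i a j)
  ... | no _  = trans (Fin.punchOut-cong a refl) (Fin.punchOut-punchIn a)

  glued : class a ≡ class b
  glued with a Fin.≟ a | a Fin.≟ b
  ... | no a≢a | _       = contradiction refl a≢a
  ... | yes _  | yes a≡b = contradiction a≡b a≢b
  ... | yes _  | no _    = Fin.punchOut-cong a refl

  only : ∀ {x y} → class x ≡ class y → x ≡ y ⊎ (x ≡ a × y ≡ b) ⊎ (x ≡ b × y ≡ a)
  only {x} {y} e with a Fin.≟ x | a Fin.≟ y
  ... | yes a≡x | yes a≡y = inj₁ (trans (sym a≡x) a≡y)
  ... | yes a≡x | no a≢y  = inj₂ (inj₁ (sym a≡x , sym (Fin.punchOut-injective a≢b a≢y e)))
  ... | no a≢x  | yes a≡y = inj₂ (inj₂ (Fin.punchOut-injective a≢x a≢b e , sym a≡y))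
  ... | no a≢x  | no a≢y  = inj₁ (Fin.punchOut-injective a≢x a≢y e)

-- Surjectivity, in the form of `member`, makes `size` the exact number of classes.
record Labelling (V : Set) : Set where
  field
    size   : ℕ
    label  : V → Fin size
    member : ∀ i → ∃ λ v → label v ≡ i

open Labelling

module _ {V : Set} where

  merge : Labelling V → V × V → Labelling V
  merge ℓ (u , v) = record
    { size   = Q.size
    ; label  = Q.class ∘ label ℓ
    ; member = λ j → let i , e = Q.member j ; w , e′ = member ℓ i in w , trans (cong Q.class e′) e
    }
    where module Q = Quotient (identify (label ℓ u) (label ℓ v))

  mergeAll : Labelling V → List (V × V) → Labelling V
  mergeAll = List.foldl merge

  merge-glues : ∀ (ℓ : Labelling V) u v →
    Glues (Quotient.class (identify (label ℓ u) (label ℓ v))) (label ℓ u) (label ℓ v)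
  merge-glues ℓ u v = Quotient.glues (identify (label ℓ u) (label ℓ v))

  mergeAll-mono : ∀ ℓ es {x y} → label ℓ x ≡ label ℓ y →
    label (mergeAll ℓ es) x ≡ label (mergeAll ℓ es) y
  mergeAll-mono ℓ []             e = e
  mergeAll-mono ℓ (d@(u , v) ∷ es) e =
    mergeAll-mono (merge ℓ d) es (cong (Quotient.class (identify (label ℓ u) (label ℓ v))) e)

  mergeAll-joins : ∀ ℓ es {u v} → (u , v) ∈ es → label (mergeAll ℓ es) u ≡ label (mergeAll ℓ es) v
  mergeAll-joins ℓ (d@(u , v) ∷ es) (here refl) =
    mergeAll-mono (merge ℓ d) es (Glues.glued (merge-glues ℓ u v))
  mergeAll-joins ℓ (d ∷ es) (there p) = mergeAll-joins (merge ℓ d) es p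

  module _ {R : Rel V 0ℓ} (R-sym : Symmetric R) (R-trans : Transitive R) where

    -- Equal labels after merging an edge come either from equal labels before or from a chain that
    -- crosses this edge once, in one direction or the other.
    mergeAll-sound : ∀ ℓ es → (∀ {x y} → label ℓ x ≡ label ℓ y → R x y) → All (uncurry R) es →
      ∀ {x y} → label (mergeAll ℓ es) x ≡ label (mergeAll ℓ es) y → R x y
    mergeAll-sound ℓ []               ℓ⇒R []       = ℓ⇒R
    mergeAll-sound ℓ (d@(u , v) ∷ es) ℓ⇒R (r ∷ rs) = mergeAll-sound (merge ℓ d) es step⇒R rs
      where
      step⇒R : ∀ {x y} → label (merge ℓ d) x ≡ label (merge ℓ d) y → R x y
      step⇒R e with Glues.only (merge-glues ℓ u v) e
      ... | inj₁ x≡y             = ℓ⇒R x≡y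
      ... | inj₂ (inj₁ (e₁ , e₂)) = R-trans (ℓ⇒R e₁) (R-trans r (ℓ⇒R (sym e₂)))
      ... | inj₂ (inj₂ (e₁ , e₂)) = R-trans (ℓ⇒R e₁) (R-trans (R-sym r) (ℓ⇒R (sym e₂)))

  module _ {m : ℕ} (b : Fin m → V) where

    -- `b` picks out the vertices that a pattern records. All merged edges join such vertices, so
    -- the pattern can follow every merge.
    along : List (Edge m) → List (V × V)
    along = List.map λ (i , j) → b i , b j

    merge-sameKernel : ∀ ℓ t (d@(u , v) : Edge m) → SameKernel (label ℓ ∘ b) (lookup t) →
      SameKernel (label (merge ℓ (b u , b v)) ∘ b) (lookup (mergePattern t d))
    merge-sameKernel ℓ t (u , v) same = sameKernel-cong (λ _ → refl)
      (λ i → sym (Vec.lookup-map i (relabel (lookup t u) (lookup t v)) t))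
      (glue-sameKernel {f = label ℓ ∘ b} {g = lookup t}
        (merge-glues ℓ (b u) (b v)) (relabel-glues (lookup t u) (lookup t v)) same)

    mergeAll-sameKernel : ∀ ℓ t es → SameKernel (label ℓ ∘ b) (lookup t) →
      SameKernel (label (mergeAll ℓ (along es)) ∘ b) (lookup (mergePatterns t es))
    mergeAll-sameKernel ℓ t []       same = same
    mergeAll-sameKernel ℓ t (d ∷ es) same =
      mergeAll-sameKernel (merge ℓ _) (mergePattern t d) es (merge-sameKernel ℓ t d same)

    -- The kernels agree, so the pattern tells whether the ends already lie in one class, that is,
    -- whether a class is lost.
    merge-size : ∀ ℓ t u v → SameKernel (label ℓ ∘ b) (lookup t) →
      size ℓ ≡ (if lookup t u ≡ᵇ lookup t v then 0 else 1) + size (merge ℓ (b u , b v))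
    merge-size ℓ t u v same with lookup t u ℕ.≟ lookup t v
    ... | yes e rewrite dec-true (lookup t u ℕ.≟ lookup t v) e =
      Quotient.size-≡ (identify (label ℓ (b u)) (label ℓ (b v))) (SameKernel.from same e)
    ... | no ne rewrite dec-false (lookup t u ℕ.≟ lookup t v) ne =
      Quotient.size-≢ (identify (label ℓ (b u)) (label ℓ (b v))) (ne ∘ SameKernel.to same)

    mergeAll-size : ∀ ℓ t es → SameKernel (label ℓ ∘ b) (lookup t) →
      size ℓ ≡ merges t es + size (mergeAll ℓ (along es))
    mergeAll-size ℓ t []               same = refl
    mergeAll-size ℓ t (d@(u , v) ∷ es) same = begin
      size ℓ
        ≡⟨ merge-size ℓ t u v same ⟩
      k + size (merge ℓ (b u , b v))
        ≡⟨ cong (k +_) (mergeAll-size (merge ℓ _) (mergePattern t d) es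
             (merge-sameKernel ℓ t d same)) ⟩
      k + (merges (mergePattern t d) es + _)
        ≡⟨ ℕ.+-assoc k (merges (mergePattern t d) es) _ ⟨
      (k + merges (mergePattern t d) es) + _
        ∎
      where
      open ≡-Reasoning
      k = if lookup t u ≡ᵇ lookup t v then 0 else 1

-- Colored partitions and monochromatic components

module _ {k : ℕ} {G : Graph} where
  open Graph G

  Mono : (V → Fin k) → Rel V 0ℓ
  Mono c v w = v ~ w × c v ≡ c w

  Mono-sym : ∀ {c} → Symmetric (Mono c)
  Mono-sym (a , e) = ~-sym a , sym e

  path-color : ∀ {c v w} → Star (Mono c) v w → c v ≡ c w
  path-color ε             = refl
  path-color ((_ , e) ◅ p) = trans e (path-color p)

  record IsComponents (c : V → Fin k) (ℓ : Labelling V) : Set where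
    field
      complete : ∀ {v w} → Mono c v w → label ℓ v ≡ label ℓ w
      sound    : ∀ {v w} → label ℓ v ≡ label ℓ w → Star (Mono c) v w

  toPartition : ∀ {c ℓ} → IsComponents c ℓ → ColoredPartition k G
  toPartition {c} {ℓ} isComps = record
    { size      = size ℓ
    ; block     = λ i v → label ℓ v ≡ i
    ; color     = λ i → c (proj₁ (member ℓ i))
    ; nonempty  = member ℓ
    ; disjoint  = λ e e′ → trans (sym e) e′
    ; cover     = λ v → label ℓ v , refl
    ; connected = λ _ e e′ → inside e (sound (trans e (sym e′)))
    -- An edge between blocks of equal color would be monochromatic, and its ends would share a
    -- label.
    ; proper    = λ { i≢j (v , w , refl , refl , v~w) e →
        i≢j (complete (v~w ,
          trans (representative-color v) (trans e (sym (representative-color w))))) }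
    }
    where
    open IsComponents isComps

    representative-color : ∀ v → c v ≡ c (proj₁ (member ℓ (label ℓ v)))
    representative-color v = path-color (sound (sym (proj₂ (member ℓ (label ℓ v)))))

    -- Each monochromatic edge preserves the label, so the path never leaves the block.
    inside : ∀ {i v w} → label ℓ v ≡ i → Star (Mono c) v w →
      Star (Induced G (λ x → label ℓ x ≡ i)) v w
    inside e ε       = ε
    inside e (s ◅ p) = (e , e′ , proj₁ s) ◅ inside e′ p
      where e′ = trans (sym (complete s)) e

  vertexColor : ColoredPartition k G → V → Fin k
  vertexColor T v = color (proj₁ (cover v))
    where open ColoredPartition T

  block-color : ∀ T {v} i → ColoredPartition.block T i v →
    vertexColor T v ≡ ColoredPartition.color T i
  block-color T {v} i v∈i = cong color (disjoint (proj₂ (cover v)) v∈i)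
    where open ColoredPartition T

  toPartition-color : ∀ {c ℓ} (isComps : IsComponents c ℓ) v →
    vertexColor (toPartition isComps) v ≡ c v
  toPartition-color {ℓ = ℓ} isComps v =
    path-color (IsComponents.sound isComps (proj₂ (member ℓ (label ℓ v))))

  vertexColor-cong : ∀ {S T} → _⊑_ {k} {G} S T → ∀ v → vertexColor S v ≡ vertexColor T v
  vertexColor-cong {S} {T} S⊑T v with ColoredPartition.cover S v
  ... | i , v∈i with S⊑T i
  ...   | j , (i⊆j , _) , e = trans e (sym (block-color T j (i⊆j v∈i)))

  -- If the edge left the block, it would lead to a neighboring block, whose color differs.
  same-block : ∀ T {i v w} → ColoredPartition.block T i v → v ~ w →
    vertexColor T v ≡ vertexColor T w → ColoredPartition.block T i w
  same-block T {i} {v} {w} v∈i v~w e with ColoredPartition.cover T w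
  ... | j , w∈j with i Fin.≟ j
  ...   | yes refl = w∈j
  ...   | no i≢j   = contradiction
    (trans (sym (block-color T i v∈i)) e) (ColoredPartition.proper T i≢j (v , w , v∈i , w∈j , v~w))

  -- A block of `S` is connected through edges with ends of equal color, and in `T` such edges stay
  -- within one block. Exchanging `S` and `T` gives the reverse inclusion of blocks.
  ⊑-color : ∀ S T → (∀ v → vertexColor S v ≡ vertexColor T v) → _⊑_ {k} {G} S T
  ⊑-color S T S≗T i with ColoredPartition.nonempty S i
  ... | v , v∈i = j , ((λ {w} w∈i → walk S T S≗T v∈j (S.connected i v∈i w∈i)) ,
                       (λ {w} w∈j → walk T S (sym ∘ S≗T) v∈i (T.connected j v∈j w∈j))) ,
    trans (sym (block-color S i v∈i)) (S≗T v)
    where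
    module S = ColoredPartition S
    module T = ColoredPartition T
    j   = proj₁ (T.cover v)
    v∈j = proj₂ (T.cover v)

    walk : ∀ S T → (∀ v → vertexColor S v ≡ vertexColor T v) → ∀ {i j v w} →
      ColoredPartition.block T j v → Star (Induced G (ColoredPartition.block S i)) v w →
      ColoredPartition.block T j w
    walk S T S≗T v∈j ε = v∈j
    walk S T S≗T {i} v∈j ((v∈i , w∈i , v~w) ◅ p) = walk S T S≗T
      (same-block T v∈j v~w (trans (sym (S≗T _))
        (trans (trans (block-color S i v∈i) (sym (block-color S i w∈i))) (S≗T _)))) p

  -- Two blocks of `S` matched with the same block of `T` have a common vertex, since blocks are
  -- nonempty. So the matching is injective.
  ⊑-size : ∀ S T → _⊑_ {k} {G} S T → ColoredPartition.size S ≤ ColoredPartition.size T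
  ⊑-size S T S⊑T = Fin.injective⇒≤ {f = proj₁ ∘ S⊑T} injective
    where
    injective : Injective _≡_ _≡_ (proj₁ ∘ S⊑T)
    injective {i} {i′} e with S⊑T i | S⊑T i′ | ColoredPartition.nonempty S i
    ... | j , (i⊆j , _) , _ | j′ , (_ , j′⊆i′) , _ | v , v∈i with refl ← e =
      ColoredPartition.disjoint S v∈i (j′⊆i′ (i⊆j v∈i))

-- The graphs K₁,₃ × Pₙ

SP : ℕ → Graph
SP n = K 1 3 □ P n

Vertex : ℕ → Set
Vertex n = Graph.V (SP n)

-- The newest column is the head of the vector and sits at position 0 of the path; `join 1 3` gives
-- the center index 0.
coloring : ∀ {n} → Vec Column n → Vertex n → Fin 2
coloring cs (a , i) = lookup (lookup cs i) (join 1 3 a)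

addColumn : ∀ {n} → Labelling (Vertex n) → Labelling (Vertex (suc n))
addColumn {n} ℓ = record { size = 4 + size ℓ ; label = label′ ; member = member′ }
  where
  label′ : Vertex (suc n) → Fin (4 + size ℓ)
  label′ (a , zero)  = join 1 3 a ↑ˡ size ℓ
  label′ (a , suc i) = 4 ↑ʳ label ℓ (a , i)

  member′ : ∀ j → ∃ λ v → label′ v ≡ j
  member′ j with splitAt 4 j in eq
  ... | inj₁ x = (splitAt 1 x , zero) ,
    trans (cong (_↑ˡ size ℓ) (Fin.join-splitAt 1 3 x)) (Fin.splitAt⁻¹-↑ˡ eq)
  ... | inj₂ y with member ℓ y
  ...   | (a , i) , e = (a , suc i) , trans (cong (4 ↑ʳ_) e) (Fin.splitAt⁻¹-↑ʳ eq)

↑ˡ≢↑ʳ : ∀ m n (i : Fin m) (j : Fin n) → i ↑ˡ n ≢ m ↑ʳ j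
↑ˡ≢↑ʳ m n i j e
  with () ← trans (sym (Fin.splitAt-↑ˡ m i n)) (trans (cong (splitAt m) e) (Fin.splitAt-↑ʳ m n j))

join-injective : ∀ a b → join 1 3 a ≡ join 1 3 b → a ≡ b
join-injective a b e =
  trans (sym (Fin.splitAt-join 1 3 a)) (trans (cong (splitAt 1) e) (Fin.splitAt-join 1 3 b))

-- The frame consists of the vertices that edges added with a column can touch: the first column
-- and, if there is one, the second.
frameSize : ℕ → ℕ
frameSize zero    = 4
frameSize (suc n) = 8

front-vertex : ∀ n → Fin 4 → Vertex (suc n)
front-vertex n i = splitAt 1 i , zero

frame : ∀ n → Fin (frameSize n) → Vertex (suc n)
frame zero    = front-vertex 0
frame (suc n) = [ front-vertex (suc n) , (λ i → splitAt 1 i , suc zero) ]′ ∘ splitAt 4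

frameColors : ∀ {n} → Vec Column (suc n) → Vec (Fin 2) (frameSize n)
frameColors (c ∷ [])     = c
frameColors (c ∷ d ∷ cs) = c Vec.++ d

edges : ∀ n → List (Edge (frameSize n))
edges zero    = starEdges 0
edges (suc n) = starEdges 4 List.++ pathEdges

newEdges : ∀ {n} → Vec Column (suc n) → List (Edge (frameSize n))
newEdges {n} cs = monochromatic (frameColors cs) (edges n)

components : ∀ {n} → Vec Column n → Labelling (Vertex n)
components {zero}  []       = record { size = 0 ; label = λ { (_ , ()) } ; member = λ () }
components {suc n} (c ∷ cs) =
  mergeAll (addColumn (components cs)) (along (frame n) (newEdges (c ∷ cs)))

frame-colors : ∀ {n} (cs : Vec Column (suc n)) i →
  lookup (frameColors cs) i ≡ coloring cs (frame n i)
frame-colors (c ∷ [])     i = cong (lookup c) (sym (Fin.join-splitAt 1 3 i))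
frame-colors (c ∷ d ∷ cs) i = trans (Vec.lookup-splitAt 4 c d i) (colors (splitAt 4 i))
  where
  colors : ∀ x → [ lookup c , lookup d ]′ x ≡
    coloring (c ∷ d ∷ cs) ([ front-vertex _ , (λ i → splitAt 1 i , suc zero) ]′ x)
  colors (inj₁ i) = cong (lookup c) (sym (Fin.join-splitAt 1 3 i))
  colors (inj₂ i) = cong (lookup d) (sym (Fin.join-splitAt 1 3 i))

edges-adjacent : ∀ n → All (λ (i , j) → Graph._~_ (SP (suc n)) (frame n i) (frame n j)) (edges n)
edges-adjacent zero    = inj₂ (refl , tt) ∷ inj₂ (refl , tt) ∷ inj₂ (refl , tt) ∷ []
edges-adjacent (suc n) = inj₂ (refl , tt) ∷ inj₂ (refl , tt) ∷ inj₂ (refl , tt)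
  ∷ inj₁ (refl , inj₁ refl) ∷ inj₁ (refl , inj₁ refl)
  ∷ inj₁ (refl , inj₁ refl) ∷ inj₁ (refl , inj₁ refl) ∷ []

star : ∀ n (R : Rel (Vertex (suc n)) 0ℓ) → All (λ (i , j) → R (frame n i) (frame n j)) (edges n) →
  ∀ k → R (inj₁ zero , zero) (inj₂ k , zero)
star zero    R (r ∷ _)         0F = r
star zero    R (_ ∷ r ∷ _)     1F = r
star zero    R (_ ∷ _ ∷ r ∷ _) 2F = r
star (suc n) R (r ∷ _)         0F = r
star (suc n) R (_ ∷ r ∷ _)     1F = r
star (suc n) R (_ ∷ _ ∷ r ∷ _) 2F = r

path : ∀ n (R : Rel (Vertex (suc n)) 0ℓ) → All (λ (i , j) → R (frame n i) (frame n j)) (edges n) →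
  ∀ a (j : Fin (suc n)) → 1 ≡ toℕ j → R (a , zero) (a , j)
path (suc n) R (_ ∷ _ ∷ _ ∷ r ∷ _)             (inj₁ 0F) 1F refl = r
path (suc n) R (_ ∷ _ ∷ _ ∷ _ ∷ r ∷ _)         (inj₂ 0F) 1F refl = r
path (suc n) R (_ ∷ _ ∷ _ ∷ _ ∷ _ ∷ r ∷ _)     (inj₂ 1F) 1F refl = r
path (suc n) R (_ ∷ _ ∷ _ ∷ _ ∷ _ ∷ _ ∷ r ∷ _) (inj₂ 2F) 1F refl = r

module _ {n : ℕ} {R : Rel (Vertex (suc n)) 0ℓ} (R-sym : Symmetric R)
         (R-old : ∀ {a i b j} → Graph._~_ (SP n) (a , i) (b , j) → R (a , suc i) (b , suc j))
         (R-new : All (λ (i , j) → R (frame n i) (frame n j)) (edges n)) where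

  -- Up to direction, every edge is either an edge of the smaller product moved by one position or
  -- one of the listed edges of the frame.
  edge-induction : ∀ {v w} → Graph._~_ (SP (suc n)) v w → R v w
  edge-induction {inj₁ 0F , zero} {inj₂ k , zero}  (inj₂ (refl , _)) = star n R R-new k
  edge-induction {inj₂ k , zero}  {inj₁ 0F , zero} (inj₂ (refl , _)) = R-sym (star n R R-new k)
  edge-induction {_ , suc _} {_ , suc _} (inj₂ (refl , a))         = R-old (inj₂ (refl , a))
  edge-induction {a , zero}  {_ , j}     (inj₁ (refl , inj₁ e))    = path n R R-new a j e
  edge-induction {a , i}     {_ , zero}  (inj₁ (refl , inj₂ e))    = R-sym (path n R R-new a i e)
  edge-induction {_ , suc _} {_ , suc _} (inj₁ (refl , inj₁ e)) =
    R-old (inj₁ (refl , inj₁ (ℕ.suc-injective e)))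
  edge-induction {_ , suc _} {_ , suc _} (inj₁ (refl , inj₂ e)) =
    R-old (inj₁ (refl , inj₂ (ℕ.suc-injective e)))

-- Induction on the columns: old components carry over by moving one position, and exactly the
-- monochromatic edges of the frame are merged.
components-correct : ∀ {n} (cs : Vec Column n) →
  IsComponents {G = SP n} (coloring cs) (components cs)
components-correct {zero}  []       = record { complete = λ { {_ , ()} } ; sound = λ { {_ , ()} } }
components-correct {suc n} (c ∷ cs) = record { complete = complete ; sound = sound }
  where
  module Old = IsComponents (components-correct cs)
  ℓ  = addColumn (components cs)
  es = along (frame n) (newEdges (c ∷ cs))
  new = label (components (c ∷ cs))

  complete : ∀ {v w} → Mono {G = SP (suc n)} (coloring (c ∷ cs)) v w → new v ≡ new w
  complete (v~w , e) = edge-induction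
    -- Equality of colors is a premise inside the relation because the induction runs over all
    -- edges, while only monochromatic ones are merged.
    {R = λ v w → coloring (c ∷ cs) v ≡ coloring (c ∷ cs) w → new v ≡ new w}
    (λ r e → sym (r (sym e)))
    (λ a~b e → mergeAll-mono ℓ es (cong (4 ↑ʳ_) (Old.complete (a~b , e))))
    (All.tabulate λ {(i , j)} ∈edges e → mergeAll-joins ℓ es
      (∈-map⁺ _ (∈-filter⁺
        (λ (u , v) → lookup (frameColors (c ∷ cs)) u Fin.≟ lookup (frameColors (c ∷ cs)) v) ∈edges
        (trans (frame-colors (c ∷ cs) i) (trans e (sym (frame-colors (c ∷ cs) j)))))))
    v~w e

  lift : ∀ {a i b j} → Star (Mono {G = SP n} (coloring cs)) (a , i) (b , j) →
    Star (Mono {G = SP (suc n)} (coloring (c ∷ cs))) (a , suc i) (b , suc j)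
  lift = Star.gmap (λ (a , i) → a , suc i) λ
    { (inj₁ (a≡b , inj₁ e) , e′) → inj₁ (a≡b , inj₁ (cong suc e)) , e′
    ; (inj₁ (a≡b , inj₂ e) , e′) → inj₁ (a≡b , inj₂ (cong suc e)) , e′
    ; (inj₂ (i≡j , a~b)    , e′) → inj₂ (cong suc i≡j , a~b) , e′ }

  old-sound : ∀ {v w} → label ℓ v ≡ label ℓ w → Star (Mono {G = SP (suc n)} (coloring (c ∷ cs))) v w
  old-sound {a , zero} {b , zero} e
    with refl ← join-injective a b (Fin.↑ˡ-injective (size (components cs)) _ _ e) = ε
  old-sound {a , zero}  {b , suc j} e = contradiction e (↑ˡ≢↑ʳ 4 _ _ _)
  old-sound {a , suc i} {b , zero}  e = contradiction (sym e) (↑ˡ≢↑ʳ 4 _ _ _)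
  old-sound {a , suc i} {b , suc j} e = lift (Old.sound (Fin.↑ʳ-injective 4 _ _ e))

  sound : ∀ {v w} → new v ≡ new w → Star (Mono {G = SP (suc n)} (coloring (c ∷ cs))) v w
  sound = mergeAll-sound {R = Star (Mono {G = SP (suc n)} (coloring (c ∷ cs)))}
    (Star.reverse (Mono-sym {G = SP (suc n)})) _◅◅_ ℓ es old-sound
    (All.map⁺ (All.map (λ {(i , j)} (v~w , e) →
        (v~w , trans (sym (frame-colors (c ∷ cs) i)) (trans e (frame-colors (c ∷ cs) j))) ◅ ε)
      (All.zip (All.filter⁺ _ (edges-adjacent n) , All.all-filter _ (edges n)))))

-- The state reached by a word of columns

words-complete : ∀ {A : Set} {xs : List A} → (∀ x → x ∈ xs) → ∀ {n} (w : Vec A n) → w ∈ words xs n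
words-complete ∈xs []      = here refl
words-complete ∈xs (x ∷ w) = ∈-cartesianProductWith⁺ _ (words-complete ∈xs w) (∈xs x)

opaque
  unfolding columns

  columns-complete : ∀ c → c ∈ columns
  columns-complete = words-complete ∈-allFin

state : ∀ {n} → Vec Column (suc n) → State
state (c ∷ [])     = init c
state (c ∷ d ∷ cs) = step (state (d ∷ cs)) c

-- The number of components that no longer meet the newest column.
closed : ∀ {n} → Vec Column (suc n) → ℕ
closed (c ∷ [])     = 0
closed (c ∷ d ∷ cs) = closed (d ∷ cs) + δ (state (d ∷ cs)) c

samePattern⇒sameKernel : ∀ t t′ → SamePattern t t′ → SameKernel (lookup t) (lookup t′)
samePattern⇒sameKernel t t′ same = record
  { to   = λ {i} {j} e → ℕ.≡ᵇ⇒≡ _ _ (subst T (same i j) (ℕ.≡⇒≡ᵇ _ _ e))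
  ; from = λ {i} {j} e → ℕ.≡ᵇ⇒≡ _ _ (subst T (sym (same i j)) (ℕ.≡⇒≡ᵇ _ _ e))
  }

discrete-toℕ : ∀ i → lookup discrete i ≡ toℕ i
discrete-toℕ 0F = refl
discrete-toℕ 1F = refl
discrete-toℕ 2F = refl
discrete-toℕ 3F = refl

addColumn-front : ∀ {n} (ℓ : Labelling (Vertex n)) →
  SameKernel (label (addColumn ℓ) ∘ front-vertex n) (lookup discrete)
addColumn-front ℓ = record
  { to   = λ {i} {j} e → cong (lookup discrete)
      (trans (sym (Fin.join-splitAt 1 3 i))
        (trans (Fin.↑ˡ-injective (size ℓ) _ _ e) (Fin.join-splitAt 1 3 j)))
  ; from = λ {i} {j} e → cong (label (addColumn ℓ) ∘ front-vertex _)
      (Fin.toℕ-injective (trans (sym (discrete-toℕ i)) (trans e (discrete-toℕ j))))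
  }

-- In the labelling and in the pattern alike, the new column has labels below 4 and the old one
-- labels of at least 4, so the kernels on the two columns combine.
addColumn-frame : ∀ {n} (ℓ : Labelling (Vertex (suc n))) {t : Pattern 4} →
  SameKernel (label ℓ ∘ front-vertex n) (lookup t) →
  SameKernel (label (addColumn ℓ) ∘ frame (suc n)) (lookup (discrete Vec.++ Vec.map (4 +_) t))
addColumn-frame {n} ℓ {t} same = sameKernel-cong
  (λ i → labels (splitAt 4 i)) (λ i → sym (Vec.lookup-splitAt 4 discrete (Vec.map (4 +_) t) i))
  (sameKernel-∘ (splitAt 4)
    (sameKernel-⊎ (λ _ _ → ↑ˡ≢↑ʳ 4 _ _ _) small≢large (addColumn-front ℓ) shifted))
  where
  labels : ∀ x →
    [ label (addColumn ℓ) ∘ front-vertex (suc n) , (λ i → 4 ↑ʳ label ℓ (front-vertex n i)) ]′ x ≡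
    label (addColumn ℓ) ([ front-vertex (suc n) , (λ i → splitAt 1 i , suc zero) ]′ x)
  labels (inj₁ _) = refl
  labels (inj₂ _) = refl

  small≢large : ∀ i j → lookup discrete i ≢ lookup (Vec.map (4 +_) t) j
  small≢large i j e = ℕ.<⇒≢ (ℕ.<-≤-trans (Fin.toℕ<n i) (ℕ.m≤m+n 4 _))
    (trans (sym (discrete-toℕ i)) (trans e (Vec.lookup-map j (4 +_) t)))

  shifted : SameKernel (λ i → 4 ↑ʳ label ℓ (front-vertex n i)) (lookup (Vec.map (4 +_) t))
  shifted = sameKernel-cong (λ _ → refl) (λ i → sym (Vec.lookup-map i (4 +_) t)) record
    { to   = λ e → cong (4 +_) (SameKernel.to same (Fin.↑ʳ-injective 4 _ _ e))
    ; from = λ e → cong (4 ↑ʳ_) (SameKernel.from same (ℕ.+-cancelˡ-≡ 4 _ _ e))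
    }

-- The invariant tying the finite automaton to the actual components of the colored graph.
record Tracks {n} (cs : Vec Column (suc n)) : Set where
  field
    column-head : Vec.head cs ≡ column (state cs)
    connections : SameKernel (label (components cs) ∘ front-vertex n)
                    (lookup (connectivity (state cs)))
    count       : size (components cs) ≡ closed cs + active (state cs)

tracks : ∀ {n} (cs : Vec Column (suc n)) → Tracks cs
tracks (c ∷ []) = record
  { column-head = c≡
  ; connections = sameKernel-trans
      (mergeAll-sameKernel (front-vertex 0) ℓ discrete es (addColumn-front (components [])))
      (samePattern⇒sameKernel (initPattern c) (connectivity (init c)) same)
  ; count       = ℕ.+-cancelˡ-≡ (merges discrete es) _ _
      (trans (sym (mergeAll-size (front-vertex 0) ℓ discrete es (addColumn-front (components []))))
        (sym merged))
  }
  where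
  ℓ  = addColumn (components [])
  es = monochromatic c (starEdges 0)
  check  = All.lookup initCorrect (columns-complete c)
  c≡     = proj₁ (proj₁ check)
  same   = proj₂ (proj₁ check)
  merged = proj₂ check
tracks {suc n} (c ∷ d ∷ cs) = record
  { column-head = c≡
  ; connections = sameKernel-trans
      (sameKernel-cong (λ i → cong (label (components (c ∷ d ∷ cs))) (frame-front i))
        (λ i → sym (Vec.lookup∘tabulate (λ i → lookup (stepPattern s c) (i ↑ˡ 4)) i))
        (sameKernel-∘ (_↑ˡ 4) (subst
          (λ es → SameKernel (label (mergeAll ℓ (along (frame (suc n)) es)) ∘ frame (suc n))
            (lookup (stepPattern s c)))
          es≡
          (mergeAll-sameKernel (frame (suc n)) ℓ (stepPattern₀ s) (stepEdges s c) same₀))))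
      (samePattern⇒sameKernel (front (stepPattern s c)) (connectivity (step s c)) same)
  -- Adding the number of merges to both sides avoids subtraction: before the merges there are the
  -- old components and four new singletons.
  ; count       = ℕ.+-cancelˡ-≡ m _ _ (begin
      m + size (components (c ∷ d ∷ cs))
        ≡⟨ cong (λ es → m + size (mergeAll ℓ (along (frame (suc n)) es))) es≡ ⟨
      m + size (mergeAll ℓ (along (frame (suc n)) (stepEdges s c)))
        ≡⟨ mergeAll-size (frame (suc n)) ℓ (stepPattern₀ s) (stepEdges s c) same₀ ⟨
      4 + size (components (d ∷ cs))
        ≡⟨ cong (4 +_) Old.count ⟩
      4 + (closed (d ∷ cs) + active s)
        ≡⟨ ℕ.+-comm 4 _ ⟩
      closed (d ∷ cs) + active s + 4
        ≡⟨ ℕ.+-assoc (closed (d ∷ cs)) _ _ ⟩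
      closed (d ∷ cs) + (active s + 4)
        ≡⟨ cong (closed (d ∷ cs) +_) merged ⟨
      closed (d ∷ cs) + (δ s c + (m + active (step s c)))
        ≡⟨ ℕ.+-assoc (closed (d ∷ cs)) _ _ ⟨
      closed (d ∷ cs) + δ s c + (m + active (step s c))
        ≡⟨ x∙yz≈y∙xz ℕ.+-commutativeSemigroup (closed (d ∷ cs) + δ s c) m _ ⟩
      m + (closed (d ∷ cs) + δ s c + active (step s c))
        ∎)
  }
  where
  open ≡-Reasoning
  module Old = Tracks (tracks (d ∷ cs))
  s = state (d ∷ cs)
  m = stepMerges s c
  ℓ = addColumn (components (d ∷ cs))
  check  = All.lookup (stepCorrect s) (columns-complete c)
  c≡     = proj₁ (proj₁ check)
  same   = proj₂ (proj₁ check)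
  merged = proj₂ check
  same₀  = addColumn-frame (components (d ∷ cs)) Old.connections

  -- The step reads the previous column off the state, and by `column-head` this is the actual
  -- column `d`.
  es≡ : stepEdges s c ≡ newEdges (c ∷ d ∷ cs)
  es≡ = cong (λ d → monochromatic (c Vec.++ d) (starEdges 4 List.++ pathEdges))
    (sym Old.column-head)

  frame-front : ∀ i → frame (suc n) (i ↑ˡ 4) ≡ front-vertex (suc n) i
  frame-front i = cong [ front-vertex (suc n) , (λ i → splitAt 1 i , suc zero) ]′
    (Fin.splitAt-↑ˡ 4 i 4)

-- Counting partitions by their colorings

-- Ended components of the n+1 chosen columns are weighted by `closed`, and `W` accounts for `m`
-- further columns. The induction hands the newest chosen column over to `W`, one recursion step at
-- a time.
closed-weight : ∀ n m → Σₚ (map (λ cs → shift (closed cs) (W (state cs) m)) (words columns (suc n)))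
                      ≋ total W (suc (n + m))
closed-weight zero m = begin
  Σₚ (map (λ cs → shift (closed cs) (W (state cs) m)) (words columns 1))
    ≈⟨ Σ-cartesianProductWith (λ cs → shift (closed cs) (W (state cs) m)) (flip _∷_)
         ([] ∷ []) columns ⟩
  Σₚ (map (λ c → W (init c) m) columns) ⊕ 0ₚ
    ≈⟨ ⊕-identityʳ _ ⟩
  Σₚ (map (λ c → W (init c) m) columns)
    ∎
  where open ≋-Reasoning
closed-weight (suc n) m = begin
  Σₚ (map (λ cs → shift (closed cs) (W (state cs) m)) (words columns (suc (suc n))))
    ≈⟨ Σ-cartesianProductWith (λ cs → shift (closed cs) (W (state cs) m)) (flip _∷_)
         (words columns (suc n)) columns ⟩
  Σₚ (map (λ cs → Σₚ (map (λ c → shift (closed (c ∷ cs)) (W (state (c ∷ cs)) m)) columns))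
    (words columns (suc n)))
    ≈⟨ Σ-cong extensions (words columns (suc n)) ⟩
  Σₚ (map (λ cs → shift (closed cs) (W (state cs) (suc m))) (words columns (suc n)))
    ≈⟨ closed-weight n (suc m) ⟩
  total W (suc (n + suc m))
    ≡⟨ cong (total W ∘ suc) (ℕ.+-suc n m) ⟩
  total W (suc (suc n + m))
    ∎
  where
  open ≋-Reasoning
  extensions : ∀ cs → Σₚ (map (λ c → shift (closed (c ∷ cs)) (W (state (c ∷ cs)) m)) columns)
                    ≋ shift (closed cs) (W (state cs) (suc m))
  extensions cs@(d ∷ _) = begin
    Σₚ (map (λ c → shift (closed cs + δ (state cs) c) (W (step (state cs) c) m)) columns)
      ≈⟨ Σ-cong (λ c → ≋-reflexive (shift-+ (closed cs) (δ (state cs) c) _)) columns ⟩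
    Σₚ (map (λ c → shift (closed cs) (shift (δ (state cs) c) (W (step (state cs) c) m))) columns)
      ≈⟨ Σ-linear (shift-linear (closed cs))
           (λ c → shift (δ (state cs) c) (W (step (state cs) c) m)) columns ⟨
    shift (closed cs) (Σₚ (map (λ c → shift (δ (state cs) c) (W (step (state cs) c) m)) columns))
      ≡⟨ cong (shift (closed cs)) (W-suc (state cs) m) ⟨
    shift (closed cs) (W (state cs) (suc m))
      ∎

colorings-total : ∀ n →
  Σₚ (map (λ cs → 1ℤ y^ size (components cs)) (words columns (suc n))) ≋ total W (suc n)
colorings-total n = begin
  Σₚ (map (λ cs → 1ℤ y^ size (components cs)) (words columns (suc n)))
    ≈⟨ Σ-cong (λ cs → ≋-reflexive (monomial cs)) (words columns (suc n)) ⟩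
  Σₚ (map (λ cs → shift (closed cs) (W (state cs) 0)) (words columns (suc n)))
    ≈⟨ closed-weight n 0 ⟩
  total W (suc (n + 0))
    ≡⟨ cong (total W ∘ suc) (ℕ.+-identityʳ n) ⟩
  total W (suc n)
    ∎
  where
  open ≋-Reasoning
  monomial : ∀ cs → 1ℤ y^ size (components cs) ≡ shift (closed cs) (W (state cs) 0)
  monomial cs = trans (cong (1ℤ y^_) (Tracks.count (tracks cs)))
    (trans (shift-+ (closed cs) (active (state cs)) _)
      (cong (shift (closed cs)) (sym (W-zero (state cs)))))

words-unique : ∀ {A : Set} {xs : List A} → Unique xs → ∀ n → Unique (words xs n)
words-unique xs! zero    = [] ∷ []
words-unique xs! (suc n) =
  Unique.cartesianProductWith⁺ (flip _∷_) (swap ∘ Vec.∷-injective) (words-unique xs! n) xs!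

opaque
  unfolding columns

  columns-unique : Unique columns
  columns-unique = words-unique (Unique.allFin⁺ 2) 4

fromFunction : ∀ {n} → (Vertex n → Fin 2) → Vec Column n
fromFunction f = tabulate λ i → tabulate λ j → f (splitAt 1 j , i)

fromFunction-cong : ∀ {n} {f g : Vertex n → Fin 2} → f ≗ g → fromFunction f ≡ fromFunction g
fromFunction-cong f≗g = Vec.tabulate-cong λ i → Vec.tabulate-cong λ j → f≗g (splitAt 1 j , i)

fromFunction-coloring : ∀ {n} (cs : Vec Column n) → fromFunction (coloring cs) ≡ cs
fromFunction-coloring cs = trans
  (Vec.tabulate-cong λ i → trans
    (Vec.tabulate-cong λ j → cong (lookup (lookup cs i)) (Fin.join-splitAt 1 3 j))
    (Vec.tabulate∘lookup (lookup cs i)))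
  (Vec.tabulate∘lookup cs)

coloring-fromFunction : ∀ {n} (f : Vertex n → Fin 2) → coloring (fromFunction f) ≗ f
coloring-fromFunction f (a , i) = begin
  lookup (lookup (fromFunction f) i) (join 1 3 a)
    ≡⟨ cong (λ c → lookup c (join 1 3 a))
         (Vec.lookup∘tabulate (λ i → tabulate λ j → f (splitAt 1 j , i)) i) ⟩
  lookup (tabulate λ j → f (splitAt 1 j , i)) (join 1 3 a)
    ≡⟨ Vec.lookup∘tabulate (λ j → f (splitAt 1 j , i)) (join 1 3 a) ⟩
  f (splitAt 1 (join 1 3 a) , i)
    ≡⟨ cong (λ a → f (a , i)) (Fin.splitAt-join 1 3 a) ⟩
  f (a , i)
    ∎
  where open ≡-Reasoning

partition : ∀ {n} → Vec Column n → ColoredPartition 2 (SP n)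
partition cs = toPartition (components-correct cs)

encode : ∀ {n} → ColoredPartition 2 (SP n) → Vec Column n
encode = fromFunction ∘ vertexColor

module _ {n : ℕ} where
  open Setoid (𝒯 2 (SP n)) using (_≈_) renaming (sym to ≈-sym)

  encode-partition : ∀ (cs : Vec Column n) → encode (partition cs) ≡ cs
  encode-partition cs = trans
    (fromFunction-cong (toPartition-color (components-correct cs))) (fromFunction-coloring cs)

  encode-cong : ∀ {S T} → S ≈ T → encode S ≡ encode T
  encode-cong {S} {T} (S⊑T , _) = fromFunction-cong (vertexColor-cong {S = S} {T} S⊑T)

  partition-encode : ∀ T → partition (encode T) ≈ T
  partition-encode T =
    ⊑-color (partition (encode T)) T same , ⊑-color T (partition (encode T)) (sym ∘ same)
    where
    same : ∀ v → vertexColor (partition (encode T)) v ≡ vertexColor T v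
    same v = trans (toPartition-color (components-correct (encode T)) v)
      (coloring-fromFunction (vertexColor T) v)

  encode-injective : ∀ {S T} → encode S ≡ encode T → S ≈ T
  encode-injective {S} {T} e = ⊑-color S T same , ⊑-color T S (sym ∘ same)
    where
    same : ∀ v → vertexColor S v ≡ vertexColor T v
    same v = trans (sym (coloring-fromFunction (vertexColor S) v))
      (trans (cong (λ cs → coloring cs v) e) (coloring-fromFunction (vertexColor T) v))

  -- Equivalent partitions have equally many blocks, so the number of blocks can be read off the
  -- coloring.
  size-encode : ∀ T → ColoredPartition.size T ≡ size (components (encode T))
  size-encode T with S⊑T , T⊑S ← partition-encode T =
    ℕ.≤-antisym (⊑-size T (partition (encode T)) T⊑S) (⊑-size (partition (encode T)) T S⊑T)

  enumeration : Enumeration (𝒯 2 (SP n))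
  enumeration = record
    { elements = map partition (words columns n)
    ; complete = λ T → Any.map⁺ (Any.map
        (λ { refl → ≈-sym {partition (encode T)} {T} (partition-encode T) })
        (words-complete columns-complete (encode T)))
    ; unique   = UniqueSetoid.map⁺ (setoid (Vec Column n)) (𝒯 2 (SP n))
        (λ {cs} {ds} e → trans (sym (encode-partition cs))
          (trans (encode-cong {partition cs} {partition ds} e) (encode-partition ds)))
        (words-unique columns-unique n)
    }

  -- Both lists are free of duplicates and contain every word, hence they are permutations of each
  -- other. This makes the generating function independent of the enumeration.
  encode-↭ : (e : Enumeration (𝒯 2 (SP n))) → map encode (Enumeration.elements e) ↭ words columns n
  encode-↭ e = ∼bag⇒↭ (unique∧set⇒bag
    (UniqueSetoid.map⁺ (𝒯 2 (SP n)) (setoid (Vec Column n))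
      (λ {S} {T} → encode-injective {S} {T}) (Enumeration.unique e))
    (words-unique columns-unique n)
    (λ {cs} → mk⇔ (λ _ → words-complete columns-complete cs)
      (λ _ → Any.map⁺ (Any.map
        (λ {T} e → trans (sym (encode-partition cs)) (encode-cong {partition cs} {T} e))
        (Enumeration.complete e (partition cs))))))

genFun-total : (e : ∀ n → Enumeration (𝒯 2 (SP n))) → ∀ n → genFun SP e n ≋ total W n
genFun-total e zero    = ≋-refl
genFun-total e (suc n) = begin
  Σₚ (map (λ T → 1ℤ y^ ColoredPartition.size T) els)
    ≡⟨ cong Σₚ (List.map-cong (λ T → cong (1ℤ y^_) (size-encode T)) els) ⟩
  Σₚ (map (weight ∘ encode) els)
    ≡⟨ cong Σₚ (List.map-∘ els) ⟩
  Σₚ (map weight (map encode els))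
    ≈⟨ Σ-↭ weight (encode-↭ (e (suc n))) ⟩
  Σₚ (map weight (words columns (suc n)))
    ≈⟨ colorings-total n ⟩
  total W (suc n)
    ∎
  where
  open ≋-Reasoning
  els = Enumeration.elements (e (suc n))
  weight : Vec Column (suc n) → Poly
  weight cs = 1ℤ y^ size (components cs)

theorem7p1 : ((n : ℕ) → Enumeration (𝒯 2 (K 1 3 □ P n))) ×
    ((e : (n : ℕ) → Enumeration (𝒯 2 (K 1 3 □ P n))) →
    genFun (λ n → K 1 3 □ P n) e ≈ p ÷ q)
theorem7p1 = (λ n → enumeration) , λ e → (λ _ → refl) ,
  λ n m → trans (coeffs (⊛-cong q n (λ k _ → genFun-total e k)) m) (total-series n m)
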